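{- (i) A crystal has no nowhere-zero $3$-flow if and only if each of its vertices has odd degree. (ii) A crystal is $\mathbb{Z}_3$-connected if and only if it is vertex-$3$-colorable.
   Context: Graphs are finite, may contain parallel edges, but have no loops. Triangle-tree: a graph formed by starting with a triangle $x_1x_2x_3$ and then repeatedly (zero or more times) adding a new vertex $x_{j+1}$ joined to exactly two vertices $y,z$ that are adjacent in the graph already constructed (so $x_{j+1},y,z$ form a triangle). A leaf of a triangle-tree is a vertex of degree $2$ in it. For $n\ge 4$ vertices, a triangle-path is a triangle-tree with precisely two leaves; a single triangle ($n=3$) is also considered a trivial triangle-path. Crystal: a graph consisting of a triangle-path plus an extra edge connecting two leaves of the triangle-path. Nowhere-zero $3$-flow: a pair $(D,f)$ where $D$ is an orientation of $G$ and $f:E(G)\to\{\pm1,\pm2\}$ satisfies $\sum_{e\in E_D^+(v)}f(e)=\sum_{e\in E_D^-(v)}f(e)$ for every vertex $v$, where $E_D^+(v)$, $E_D^-(v)$ are the sets of arcs leaving and entering $v$. $\mathbb{Z}_3$-connected: a $\mathbb{Z}_3$-boundary of $G$ is a map $\beta:V(G)\to\mathbb{Z}_3$ with $\sum_{v\in V(G)}\beta(v)\equiv 0\pmod 3$. $G$ is $\mathbb{Z}_3$-connected if for every $\mathbb{Z}_3$-boundary $\beta$ there is an orientation $D$ of $G$ with $d_D^+(v)-d_D^-(v)\equiv\beta(v)\pmod 3$ for every vertex $v$ (out-degree minus in-degree). -}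

module Defs where

open import Algebra.Properties.CommutativeMonoid.Sum as Sum using ()
open import Data.Bool.Base using (Bool; true; false; if_then_else_)
open import Data.Fin.Base using (Fin; zero; suc; toℕ)
open import Data.Fin.Patterns using (0F; 1F; 2F)
open import Data.Fin.Permutation using (Permutation; _⟨$⟩ʳ_)
open import Data.Fin.Properties using (_≟_; suc-injective)
open import Data.Integer.Base using (ℤ; +_; 0ℤ; _-_; -_)
open import Data.Integer.Divisibility.Signed using () renaming (_∣_ to _∣ℤ_)
open import Data.Integer.Properties using () renaming (+-0-commutativeMonoid to ℤ-+-0)
open import Data.List.Base using (_∷_; [])
open import Data.List.Membership.Propositional using (_∈_)
open import Data.Nat.Base using (ℕ; suc; _≤_)
open import Data.Nat.Divisibility using (_∣_)
open import Data.Nat.Properties using () renaming (+-0-commutativeMonoid to ℕ-+-0)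
open import Data.Product.Base using (Σ-syntax; ∃-syntax; _×_)
open import Data.Sum.Base using (_⊎_)
open import Function.Base using (_∘_)
open import Relation.Binary.PropositionalEquality using (_≡_; _≢_)
open import Relation.Nullary using (¬_; does; Dec)
open import Relation.Nullary.Decidable using (_⊎-dec_)

∑ℕ : ∀ {n} → (Fin n → ℕ) → ℕ
∑ℕ = Sum.sum ℕ-+-0

∑ℤ : ∀ {n} → (Fin n → ℤ) → ℤ
∑ℤ = Sum.sum ℤ-+-0

count : ∀ {n} {P : Fin n → Set} → (∀ i → Dec (P i)) → ℕ
count P? = ∑ℕ λ i → if does (P? i) then 1 else 0

infix 4 _≡_[mod-3]

_≡_[mod-3] : ℤ → ℤ → Set
a ≡ b [mod-3] = + 3 ∣ℤ (a - b)

-- Finite loopless multigraphs.  Edges are undirected: which end of an edge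
-- is called end₁ and which end₂ carries no information, and _≅_ ignores it.
record Graph : Set where
  field
    ∣V∣ ∣E∣  : ℕ
    end₁ end₂ : Fin ∣E∣ → Fin ∣V∣
    loopless  : ∀ e → end₁ e ≢ end₂ e

  Vertex Edge : Set
  Vertex = Fin ∣V∣
  Edge   = Fin ∣E∣

  Joins : Edge → Vertex → Vertex → Set
  Joins e x y = (end₁ e ≡ x × end₂ e ≡ y) ⊎ (end₁ e ≡ y × end₂ e ≡ x)

  Adjacent : Vertex → Vertex → Set
  Adjacent x y = ∃[ e ] Joins e x y

  Incident : Vertex → Edge → Set
  Incident v e = end₁ e ≡ v ⊎ end₂ e ≡ v

  incident? : ∀ v e → Dec (Incident v e)
  incident? v e = (end₁ e ≟ v) ⊎-dec (end₂ e ≟ v)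

  degree : Vertex → ℕ
  degree v = count (incident? v)

  Leaf : Vertex → Set
  Leaf v = degree v ≡ 2

open Graph

record _≅_ (G H : Graph) : Set where
  field
    vertices : Permutation (∣V∣ G) (∣V∣ H)
    edges    : Permutation (∣E∣ G) (∣E∣ H)
    ends     : ∀ e → Joins H (edges ⟨$⟩ʳ e)
                       (vertices ⟨$⟩ʳ end₁ G e) (vertices ⟨$⟩ʳ end₂ G e)

triangle : Graph
triangle = record
  { ∣V∣      = 3
  ; ∣E∣      = 3
  ; end₁     = λ { 0F → 0F ; 1F → 1F ; 2F → 0F }
  ; end₂     = λ { 0F → 1F ; 1F → 2F ; 2F → 2F }
  ; loopless = λ { 0F () ; 1F () ; 2F () }
  }

-- The new vertex is zero, joined to y and z by the edges 0F and 1F; an old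
-- vertex v becomes suc v and an old edge e becomes suc (suc e).
attach : (G : Graph) → Vertex G → Vertex G → Graph
attach G y z = record
  { ∣V∣      = suc (∣V∣ G)
  ; ∣E∣      = suc (suc (∣E∣ G))
  ; end₁     = λ { zero → zero  ; (suc zero) → zero  ; (suc (suc e)) → suc (end₁ G e) }
  ; end₂     = λ { zero → suc y ; (suc zero) → suc z ; (suc (suc e)) → suc (end₂ G e) }
  ; loopless = λ { zero () ; (suc zero) () ; (suc (suc e)) → loopless G e ∘ suc-injective }
  }

addEdge : (G : Graph) (x y : Vertex G) → x ≢ y → Graph
addEdge G x y x≢y = record
  { ∣V∣      = ∣V∣ G
  ; ∣E∣      = suc (∣E∣ G)
  ; end₁     = λ { zero → x ; (suc e) → end₁ G e }
  ; end₂     = λ { zero → y ; (suc e) → end₂ G e }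
  ; loopless = λ { zero → x≢y ; (suc e) → loopless G e }
  }

data TriangleTree : Graph → Set where
  base    : TriangleTree triangle
  extend  : ∀ {G} {y z : Vertex G} → TriangleTree G → Adjacent G y z →
            TriangleTree (attach G y z)
  relabel : ∀ {G H} → TriangleTree G → G ≅ H → TriangleTree H

PreciselyTwoLeaves : Graph → Set
PreciselyTwoLeaves G =
  ∃[ u ] ∃[ v ] u ≢ v × Leaf G u × Leaf G v × (∀ w → Leaf G w → w ≡ u ⊎ w ≡ v)

-- The single triangle has three leaves, hence the separate case.
TrianglePath : Graph → Set
TrianglePath G =
  TriangleTree G × (∣V∣ G ≡ 3 ⊎ (4 ≤ ∣V∣ G × PreciselyTwoLeaves G))

-- The trivial triangle-path is allowed here; it yields a triangle with one
-- edge doubled.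
Crystal : Graph → Set
Crystal G =
  Σ[ P ∈ Graph ] Σ[ x ∈ Vertex P ] Σ[ y ∈ Vertex P ] Σ[ x≢y ∈ x ≢ y ]
    TrianglePath P × Leaf P x × Leaf P y × addEdge P x y x≢y ≅ G

-- true directs an edge from end₁ to end₂, false from end₂ to end₁.
Orientation : Graph → Set
Orientation G = Edge G → Bool

module _ (G : Graph) (D : Orientation G) where

  tail head : Edge G → Vertex G
  tail e = if D e then end₁ G e else end₂ G e
  head e = if D e then end₂ G e else end₁ G e

  outDegree inDegree : Vertex G → ℕ
  outDegree v = count λ e → tail e ≟ v
  inDegree  v = count λ e → head e ≟ v

  outFlow inFlow : (Edge G → ℤ) → Vertex G → ℤ
  outFlow f v = ∑ℤ λ e → if does (tail e ≟ v) then f e else 0ℤ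
  inFlow  f v = ∑ℤ λ e → if does (head e ≟ v) then f e else 0ℤ

  IsNowhereZero3Flow : (Edge G → ℤ) → Set
  IsNowhereZero3Flow f =
    (∀ e → f e ∈ (+ 1 ∷ - + 1 ∷ + 2 ∷ - + 2 ∷ [])) × (∀ v → outFlow f v ≡ inFlow f v)

HasNowhereZero3Flow : Graph → Set
HasNowhereZero3Flow G =
  Σ[ D ∈ Orientation G ] Σ[ f ∈ (Edge G → ℤ) ] IsNowhereZero3Flow G D f

-- ℤ₃ is represented by Fin 3, via residues.
IsBoundary : (G : Graph) → (Vertex G → Fin 3) → Set
IsBoundary G β = 3 ∣ ∑ℕ (toℕ ∘ β)

ℤ₃-Connected : Graph → Set
ℤ₃-Connected G = ∀ β → IsBoundary G β →
  Σ[ D ∈ Orientation G ] ∀ v → + outDegree G D v - + inDegree G D v ≡ + toℕ (β v) [mod-3]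

Vertex-3-Colorable : Graph → Set
Vertex-3-Colorable G =
  Σ[ c ∈ (Vertex G → Fin 3) ] ∀ x y → Adjacent G x y → c x ≢ c y

Odd : ℕ → Set
Odd n = ¬ 2 ∣ n

{-# OPTIONS --safe #-}

-- Modulo 3, an orientation or a nowhere-zero flow assigns a nonzero value to every edge.  Let T be
-- a triangle-tree with proper 3-colouring c.  Removing its vertices in the reverse order of their
-- attachment shows that the boundaries with zero sum that T does not realise are exactly the
-- combinations Σ ±1_t of the indicators of its triangles, and that the 1_t span the boundaries
-- orthogonal to c.  An extra edge xy shifts the boundary to be realised on T by δ_x - δ_y or by
-- δ_y - δ_x, as we choose.  If c x ≠ c y, one of the two shifts is not orthogonal to c.  If
-- c x = c y, then δ_x - δ_y = Σ d_t 1_t, and since each d_t is a difference of two nonzero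
-- elements, some boundary has both its shifts unrealisable.  This is (ii).
--
-- For (i), grow the triangle-path one triangle at a time, away from the leaf v.  Which flows exist
-- is determined by the parities of the degrees: as long as all finished vertices have odd degree,
-- exactly one type of flow at the growing edge pq is missing, and once a vertex of even degree is
-- finished, none is.  Following integer values from the start avoids Tutte's theorem on the
-- equivalence of integer 3-flows and flows modulo 3.

module Submission where

open import Defs
open import Algebra.Bundles using (AbelianGroup)
open import Algebra.Core using (Op₁; Op₂)
import Algebra.Properties.AbelianGroup as AbelianGroupProperties
import Algebra.Properties.CommutativeMonoid.Sum as Sum
open import Algebra.Structures using (IsAbelianGroup)
open import Data.Bool.Base using (Bool; true; false; if_then_else_; _∨_)
open import Data.Bool.Properties using (∨-comm)
open import Data.Fin.Base using (Fin; zero; suc; toℕ)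
open import Data.Fin.Patterns using (0F; 1F; 2F; 3F; 4F)
import Data.Fin.Permutation as Perm
open import Data.Fin.Properties using (_≟_; all?; any?; suc-injective)
open import Data.Integer.Divisibility.Signed
  using (∣⇒∣ᵤ; ∣ᵤ⇒∣) renaming (_∣_ to _∣ℤ_; _∣?_ to _∣ℤ?_; ∣m∣n⇒∣m+n to ∣ℤ-+; ∣m⇒∣-m to ∣ℤ-neg)
open import Data.Integer.Properties using (+-0-isAbelianGroup; i-j≡0⇒i≡j; i≡j⇒i-j≡0; +-identityʳ)
open import Data.Integer.Solver using (module +-*-Solver)
open import Data.List.Base using ([]; _∷_)
open import Data.List.Membership.Propositional using (_∈_)
open import Data.List.Relation.Unary.Any using (here; there)
open import Data.Nat.Base using (ℕ; _≤_; s≤s; z≤n)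
open import Data.Nat.Divisibility using (_∣_; divides; _∣?_; ∣m∣n⇒∣m+n; ∣m+n∣m⇒∣n)
open import Data.Nat.Properties
  using (m≤n⇒m≤1+n; n≮n) renaming (+-comm to ℕ-+-comm; +-0-commutativeMonoid to ℕ-+-0)
open import Data.Product.Base using (Σ-syntax; ∃-syntax; _×_; _,_; proj₁; proj₂)
open import Data.Sum.Base using (_⊎_; inj₁; inj₂; [_,_]; swap)
open import Data.Vec.Base using (Vec; []; _∷_; lookup)
open import Function.Base using (_∘_; id)
open import Function.Bundles using (_⇔_; mk⇔)
open import Level using (0ℓ)
open import Relation.Binary.PropositionalEquality hiding ([_])
open import Relation.Binary.PropositionalEquality.Algebra using (isMagma)
open import Relation.Nullary using (¬_; does; Dec; yes; no; contradiction)
open import Relation.Nullary.Decidable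
  using (from-yes; from-no; _→-dec_; _×-dec_; _⊎-dec_; ¬?; True; toWitness; dec-true; dec-false)

open Graph
open Perm using (Permutation; _⟨$⟩ʳ_; _⟨$⟩ˡ_)

private variable
  G H K : Graph

-- Isomorphisms, and flows with prescribed boundary over an abelian group

flip-≅ : ∀ {G H} (i : G ≅ H) → let open _≅_ i in
         ∀ e → Joins H e (vertices ⟨$⟩ʳ end₁ G (edges ⟨$⟩ˡ e)) (vertices ⟨$⟩ʳ end₂ G (edges ⟨$⟩ˡ e))
flip-≅ {G} {H} i e = subst (λ e′ → Joins H e′ (φ (end₁ G d)) (φ (end₂ G d))) (Perm.inverseʳ edges) (ends d)
  where
  open _≅_ i
  d = edges ⟨$⟩ˡ e
  φ = vertices ⟨$⟩ʳ_

permutation-injective : ∀ {m n} (π : Permutation m n) {i j} → π ⟨$⟩ʳ i ≡ π ⟨$⟩ʳ j → i ≡ j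
permutation-injective π eq =
  trans (sym (Perm.inverseˡ π)) (trans (cong (π ⟨$⟩ˡ_) eq) (Perm.inverseˡ π))

does-permute : ∀ {m n} (π : Permutation m n) i j → does (π ⟨$⟩ʳ i ≟ π ⟨$⟩ʳ j) ≡ does (i ≟ j)
does-permute π i j with i ≟ j
... | yes refl = dec-true (π ⟨$⟩ʳ i ≟ π ⟨$⟩ʳ i) refl
... | no i≢j   = dec-false (π ⟨$⟩ʳ i ≟ π ⟨$⟩ʳ j) (i≢j ∘ permutation-injective π)

-- Instantiated below over ℤ₃ with nonzero values and over ℤ with values ±1, ±2. `Q` is closed under
-- negation because an isomorphism may exchange the two ends of an edge.
module Flow {A : Set} {_+_ : Op₂ A} {0# : A} { -_ : Op₁ A}
  (isAbelianGroup : IsAbelianGroup _≡_ _+_ 0# -_)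
  (Q : A → Set) (Q-neg : ∀ {x} → Q x → Q (- x)) where

  open IsAbelianGroup isAbelianGroup
    using (assoc; comm; identityˡ; identityʳ; inverseˡ; inverseʳ)

  abelianGroup : AbelianGroup 0ℓ 0ℓ
  abelianGroup = record { isAbelianGroup = isAbelianGroup }

  open Sum (AbelianGroup.commutativeMonoid abelianGroup) public
    using (sum; sum-cong-≗; ∑-distrib-+; sum-permute; sum-replicate-zero)
  open AbelianGroupProperties abelianGroup using (∙-cancelʳ; ε⁻¹≈ε; ⁻¹-involutive; ⁻¹-∙-comm)

  δ : ∀ {n} → Fin n → A → Fin n → A
  δ i a j = if does (i ≟ j) then a else 0#

  δ-neg : ∀ {n} (i : Fin n) a j → δ i (- a) j ≡ - δ i a j
  δ-neg i a j with does (i ≟ j)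
  ... | true  = refl
  ... | false = sym ε⁻¹≈ε

  δ-+ : ∀ {n} (i : Fin n) a b j → δ i (a + b) j ≡ δ i a j + δ i b j
  δ-+ i a b j with does (i ≟ j)
  ... | true  = refl
  ... | false = sym (identityˡ 0#)

  δ-0 : ∀ {n} (i j : Fin n) → δ i 0# j ≡ 0#
  δ-0 i j with does (i ≟ j)
  ... | true  = refl
  ... | false = refl

  -- Net outflow, with every edge directed from `end₁` to `end₂`.
  ∂ : (G : Graph) → (Edge G → A) → Vertex G → A
  ∂ G f v = sum λ e → δ (end₁ G e) (f e) v + δ (end₂ G e) (- f e) v

  ∂-cong : ∀ G {f g : Edge G → A} → (∀ e → f e ≡ g e) → ∀ v → ∂ G f v ≡ ∂ G g v
  ∂-cong G f≗g v = sum-cong-≗ λ e → cong (λ a → δ (end₁ G e) a v + δ (end₂ G e) (- a) v) (f≗g e)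

  sum-neg : ∀ {n} (g : Fin n → A) → sum (λ i → - g i) ≡ - sum g
  sum-neg {ℕ.zero}  g = sym ε⁻¹≈ε
  sum-neg {ℕ.suc n} g = trans (cong ((- g zero) +_) (sum-neg (g ∘ suc))) (⁻¹-∙-comm _ _)

  -- Reversing an edge amounts to negating its value, so an orientation together with values is
  -- encoded by signed values alone.
  ∂-orientation : ∀ G (D : Orientation G) (f : Edge G → A) v →
    ∂ G (λ e → if D e then f e else - f e) v ≡
    sum (λ e → δ (tail G D e) (f e) v) + (- sum (λ e → δ (head G D e) (f e) v))
  ∂-orientation G D f v = begin
    ∂ G (λ e → if D e then f e else - f e) v
      ≡⟨ sum-cong-≗ {∣E∣ G} term ⟩
    sum (λ e → δ (tail G D e) (f e) v + (- δ (head G D e) (f e) v))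
      ≡⟨ ∑-distrib-+ {∣E∣ G} _ _ ⟩
    sum (λ e → δ (tail G D e) (f e) v) + sum (λ e → - δ (head G D e) (f e) v)
      ≡⟨ cong (sum (λ e → δ (tail G D e) (f e) v) +_) (sum-neg {∣E∣ G} _) ⟩
    sum (λ e → δ (tail G D e) (f e) v) + (- sum (λ e → δ (head G D e) (f e) v)) ∎
    where
    open ≡-Reasoning
    term : ∀ e → δ (end₁ G e) (if D e then f e else - f e) v + δ (end₂ G e) (- (if D e then f e else - f e)) v ≡
                 δ (tail G D e) (f e) v + (- δ (head G D e) (f e) v)
    term e with D e
    ... | true  = cong (_ +_) (δ-neg (end₂ G e) (f e) v)
    ... | false = trans (comm _ _)
      (cong₂ _+_ (cong (λ a → δ (end₂ G e) a v) (⁻¹-involutive (f e))) (δ-neg (end₁ G e) (f e) v))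

  record HasFlow (G : Graph) (β : Vertex G → A) : Set where
    constructor flow
    field
      value    : Edge G → A
      allowed  : ∀ e → Q (value e)
      boundary : ∀ v → ∂ G value v ≡ β v

  flow-resp : ∀ {G} {β γ : Vertex G → A} → (∀ v → β v ≡ γ v) → HasFlow G β → HasFlow G γ
  flow-resp β≗γ (flow f q ∂f≡) = flow f q λ v → trans (∂f≡ v) (β≗γ v)

  private
    cancel : ∀ x y c → ((((0# + (- x)) + ((0# + (- y)) + c)) + x) + y) ≡ c
    cancel x y c = begin
      (((0# + (- x)) + ((0# + (- y)) + c)) + x) + y
                                        ≡⟨ cong₂ (λ s t → ((s + (t + c)) + x) + y) (identityˡ _) (identityˡ _) ⟩
      (((- x) + ((- y) + c)) + x) + y   ≡⟨ cong (_+ y) (comm _ x) ⟩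
      (x + ((- x) + ((- y) + c))) + y   ≡⟨ cong (_+ y) (sym (assoc x (- x) _)) ⟩
      ((x + (- x)) + ((- y) + c)) + y   ≡⟨ cong (λ s → (s + ((- y) + c)) + y) (inverseʳ x) ⟩
      (0# + ((- y) + c)) + y            ≡⟨ cong (_+ y) (identityˡ _) ⟩
      ((- y) + c) + y                   ≡⟨ comm _ y ⟩
      y + ((- y) + c)                   ≡⟨ sym (assoc y (- y) c) ⟩
      (y + (- y)) + c                   ≡⟨ cong (_+ c) (inverseʳ y) ⟩
      0# + c                            ≡⟨ identityˡ c ⟩
      c                                 ∎
      where open ≡-Reasoning

    ∂-zero : ∀ {G} y z (f : Edge (attach G y z) → A) →
             ∂ (attach G y z) f zero ≡ f zero + f (suc zero)
    ∂-zero {G} y z f = begin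
      (f zero + 0#) + ((f (suc zero) + 0#) + sum {∣E∣ G} (λ _ → 0# + 0#))
        ≡⟨ cong₂ _+_ (identityʳ _) (cong₂ _+_ (identityʳ _)
             (trans (sum-cong-≗ {∣E∣ G} λ _ → identityˡ 0#) (sum-replicate-zero (∣E∣ G)))) ⟩
      f zero + (f (suc zero) + 0#)
        ≡⟨ cong (f zero +_) (identityʳ _) ⟩
      f zero + f (suc zero) ∎
      where open ≡-Reasoning

    ∂-suc : ∀ {G} y z (f : Edge (attach G y z) → A) w →
            (∂ (attach G y z) f (suc w) + δ y (f zero) w) + δ z (f (suc zero)) w ≡
            ∂ G (f ∘ suc ∘ suc) w
    ∂-suc {G} y z f w = trans
      (cong₂ (λ s t → (((0# + s) + ((0# + t) + ∂ G (f ∘ suc ∘ suc) w)) + δ y (f zero) w) + δ z (f (suc zero)) w)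
        (δ-neg y (f zero) w) (δ-neg z (f (suc zero)) w))
      (cancel (δ y (f zero) w) (δ z (f (suc zero)) w) (∂ G (f ∘ suc ∘ suc) w))

  -- The new edges carry `a` and `b` from the new vertex into `y` and `z`, so `G` must send out
  -- these amounts there on top of the prescribed boundary.
  attach⁺ : ∀ {G y z} {β : Vertex (attach G y z) → A} a b → Q a → Q b → a + b ≡ β zero →
            HasFlow G (λ w → (β (suc w) + δ y a w) + δ z b w) → HasFlow (attach G y z) β
  attach⁺ {G} {y} {z} {β} a b qa qb a+b≡β (flow f q ∂f≡) = flow g qg ∂g≡
    where
    g : Edge (attach G y z) → A
    g zero          = a
    g (suc zero)    = b
    g (suc (suc e)) = f e

    qg : ∀ e → Q (g e)
    qg zero          = qa
    qg (suc zero)    = qb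
    qg (suc (suc e)) = q e

    ∂g≡ : ∀ v → ∂ (attach G y z) g v ≡ β v
    ∂g≡ zero    = trans (∂-zero {G} y z g) a+b≡β
    ∂g≡ (suc w) = ∙-cancelʳ _ _ _ (∙-cancelʳ _ _ _ (trans (∂-suc {G} y z g w) (∂f≡ w)))

  attach⁻ : ∀ {G y z} {β : Vertex (attach G y z) → A} → HasFlow (attach G y z) β →
            ∃[ a ] ∃[ b ] Q a × Q b × a + b ≡ β zero ×
            HasFlow G (λ w → (β (suc w) + δ y a w) + δ z b w)
  attach⁻ {G} {y} {z} (flow f q ∂f≡) =
    f zero , f (suc zero) , q zero , q (suc zero) , trans (sym (∂-zero {G} y z f)) (∂f≡ zero) ,
    flow (f ∘ suc ∘ suc) (q ∘ suc ∘ suc)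
      λ w → trans (sym (∂-suc {G} y z f w))
        (cong (λ s → (s + δ y (f zero) w) + δ z (f (suc zero)) w) (∂f≡ (suc w)))

  private
    ∂-addEdge : ∀ {G x y x≢y} (f : Edge (addEdge G x y x≢y) → A) w →
                (δ x (- f zero) w + δ y (f zero) w) + ∂ (addEdge G x y x≢y) f w ≡ ∂ G (f ∘ suc) w
    ∂-addEdge {G} {x} {y} f w = begin
      (δ x (- a) w + δ y a w) + ((δ x a w + δ y (- a) w) + d)
        ≡⟨ cong₂ (λ s t → (s + δ y a w) + ((δ x a w + t) + d)) (δ-neg x a w) (δ-neg y a w) ⟩
      ((- X) + Y) + ((X + (- Y)) + d)
        ≡⟨ sym (assoc _ _ d) ⟩
      (((- X) + Y) + (X + (- Y))) + d
        ≡⟨ cong (λ s → (s + (X + (- Y))) + d)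
             (trans (cong ((- X) +_) (sym (⁻¹-involutive Y))) (⁻¹-∙-comm X (- Y))) ⟩
      ((- (X + (- Y))) + (X + (- Y))) + d
        ≡⟨ cong (_+ d) (inverseˡ _) ⟩
      0# + d
        ≡⟨ identityˡ d ⟩
      d ∎
      where
      open ≡-Reasoning
      a = f zero
      d = ∂ G (f ∘ suc) w
      X = δ x a w
      Y = δ y a w

  addEdge⁺ : ∀ {G x y x≢y} {β : Vertex G → A} a → Q a →
             HasFlow G (λ w → (δ x (- a) w + δ y a w) + β w) → HasFlow (addEdge G x y x≢y) β
  addEdge⁺ {G} {x} {y} {x≢y} {β} a qa (flow f q ∂f≡) = flow g qg ∂g≡
    where
    g : Edge (addEdge G x y x≢y) → A
    g zero    = a
    g (suc e) = f e

    qg : ∀ e → Q (g e)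
    qg zero    = qa
    qg (suc e) = q e

    ∂g≡ : ∀ v → ∂ (addEdge G x y x≢y) g v ≡ β v
    ∂g≡ v = AbelianGroupProperties.∙-cancelˡ abelianGroup _ _ _
      (trans (∂-addEdge {G} {x} {y} {x≢y} g v) (∂f≡ v))

  addEdge⁻ : ∀ {G x y x≢y} {β : Vertex G → A} → HasFlow (addEdge G x y x≢y) β →
             ∃[ a ] Q a × HasFlow G (λ w → (δ x (- a) w + δ y a w) + β w)
  addEdge⁻ {G} {x} {y} {x≢y} (flow f q ∂f≡) =
    f zero , q zero , flow (f ∘ suc) (q ∘ suc)
      λ w → trans (sym (∂-addEdge {G} {x} {y} {x≢y} f w))
        (cong ((δ x (- f zero) w + δ y (f zero) w) +_) (∂f≡ w))

  transport : ∀ {G H} (i : G ≅ H) {β : Vertex H → A} →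
              HasFlow G (β ∘ (_≅_.vertices i ⟨$⟩ʳ_)) → HasFlow H β
  transport {G} {H} i {β} (flow f q ∂f≡) =
    flow (λ e → g e (flip-≅ i e)) (λ e → qg e (flip-≅ i e)) ∂g≡
    where
    open _≅_ i
    φ = vertices ⟨$⟩ʳ_
    d : Edge H → Edge G
    d = edges ⟨$⟩ˡ_

    -- The value of an edge changes sign when the isomorphism exchanges end₁ and end₂.
    g : ∀ e → Joins H e (φ (end₁ G (d e))) (φ (end₂ G (d e))) → A
    g e (inj₁ _) = f (d e)
    g e (inj₂ _) = - f (d e)

    qg : ∀ e j → Q (g e j)
    qg e (inj₁ _) = q (d e)
    qg e (inj₂ _) = Q-neg (q (d e))

    δ-φ : ∀ u a v → δ (φ u) a (φ v) ≡ δ u a v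
    δ-φ u a v = cong (if_then a else 0#) (does-permute vertices u v)

    term : ∀ e j v → δ (end₁ H e) (g e j) (φ v) + δ (end₂ H e) (- g e j) (φ v) ≡
                     δ (end₁ G (d e)) (f (d e)) v + δ (end₂ G (d e)) (- f (d e)) v
    term e (inj₁ (p , p′)) v rewrite p | p′ = cong₂ _+_ (δ-φ _ _ v) (δ-φ _ _ v)
    term e (inj₂ (p , p′)) v rewrite p | p′ | ⁻¹-involutive (f (d e)) =
      trans (cong₂ _+_ (δ-φ _ _ v) (δ-φ _ _ v)) (comm _ _)

    ∂g-φ : ∀ v → ∂ H (λ e → g e (flip-≅ i e)) (φ v) ≡ ∂ G f v
    ∂g-φ v = trans (sum-cong-≗ λ e → term e (flip-≅ i e) v) (sym (sum-permute _ (Perm.flip edges)))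

    ∂g≡ : ∀ v → ∂ H (λ e → g e (flip-≅ i e)) v ≡ β v
    ∂g≡ v = subst (λ u → ∂ H (λ e → g e (flip-≅ i e)) u ≡ β u) (Perm.inverseʳ vertices)
      (trans (∂g-φ (vertices ⟨$⟩ˡ v)) (∂f≡ (vertices ⟨$⟩ˡ v)))

  private
    shuffle : ∀ g h x y → (((0# + g) + h) + x) + y ≡ ((g + x) + y) + h
    shuffle g h x y = begin
      (((0# + g) + h) + x) + y       ≡⟨ cong (λ s → ((s + h) + x) + y) (identityˡ g) ⟩
      ((g + h) + x) + y              ≡⟨ cong (_+ y) (assoc g h x) ⟩
      (g + (h + x)) + y              ≡⟨ cong (λ s → (g + s) + y) (comm h x) ⟩
      (g + (x + h)) + y              ≡⟨ cong (_+ y) (sym (assoc g x h)) ⟩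
      ((g + x) + h) + y              ≡⟨ assoc (g + x) h y ⟩
      (g + x) + (h + y)              ≡⟨ cong ((g + x) +_) (comm h y) ⟩
      (g + x) + (y + h)              ≡⟨ sym (assoc (g + x) y h) ⟩
      ((g + x) + y) + h              ∎
      where open ≡-Reasoning

  -- Boundary a at p, b at q and c at v.  It is opaque so that unification can recover p, q and v.
  opaque
    at : ∀ {n} → Fin n → Fin n → Fin n → A → A → A → Fin n → A
    at p q v a b c w = (δ p a w + δ q b w) + δ v c w

    at-def : ∀ {n} (p q v : Fin n) a b c w → at p q v a b c w ≡ (δ p a w + δ q b w) + δ v c w
    at-def p q v a b c w = refl

    at-flip : ∀ {n} (p q v : Fin n) {a b c} w → at p q v a b c w ≡ at q p v b a c w
    at-flip p q v w = cong (_+ δ v _ w) (comm _ _)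

    at-new : ∀ {n} (p v : Fin n) α γ c → at zero (suc p) (suc v) α γ c zero ≡ α
    at-new p v α γ c = trans (identityʳ _) (identityʳ α)

    at-old : ∀ {n} (p q v : Fin n) k l α γ c w →
             (at zero (suc p) (suc v) α γ c (suc w) + δ p k w) + δ q l w ≡ at p q v (γ + k) l c w
    at-old p q v k l α γ c w = trans (shuffle (δ p γ w) (δ v c w) (δ p k w) (δ q l w))
      (cong (λ s → (s + δ q l w) + δ v c w) (sym (δ-+ p γ k w)))

    at-chord : ∀ {n} (p v : Fin n) a w →
               (δ zero (- a) w + δ (suc v) a w) + 0# ≡ at zero (suc p) (suc v) (- a) 0# a w
    at-chord p v a w = trans (identityʳ _)
      (cong (_+ δ (suc v) a w) (sym (trans (cong (δ zero (- a) w +_) (δ-0 (suc p) w)) (identityʳ _))))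

    at-permute : ∀ {m n} (π : Permutation m n) p q v {a b c} w →
                 at (π ⟨$⟩ʳ p) (π ⟨$⟩ʳ q) (π ⟨$⟩ʳ v) a b c (π ⟨$⟩ʳ w) ≡ at p q v a b c w
    at-permute π p q v {a} {b} {c} w = cong₂ _+_ (cong₂ _+_ (δ-permute p a) (δ-permute q b)) (δ-permute v c)
      where
      δ-permute : ∀ u a → δ (π ⟨$⟩ʳ u) a (π ⟨$⟩ʳ w) ≡ δ u a w
      δ-permute u a = cong (if_then a else 0#) (does-permute π u w)

  flow-flip : ∀ {G} {p q v : Vertex G} {a b c} →
              HasFlow G (at p q v a b c) → HasFlow G (at q p v b a c)
  flow-flip {p = p} {q} {v} = flow-resp (at-flip p q v)

  at-transport : ∀ {G H} (i : G ≅ H) {p q v : Vertex G} {a b c} → let φ = _≅_.vertices i ⟨$⟩ʳ_ in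
                 HasFlow G (at p q v a b c) → HasFlow H (at (φ p) (φ q) (φ v) a b c)
  at-transport i {p} {q} {v} = transport i ∘ flow-resp (λ w → sym (at-permute (_≅_.vertices i) p q v w))

  -- The next growing edge joins the new vertex to `p`. The vertex `q` is finished: its boundary is
  -- now 0, so on `G` it has to send out exactly the `l` that it receives.
  grow⁺ : ∀ {G} {p q v : Vertex G} {α γ c} k l → Q k → Q l → k + l ≡ α →
          HasFlow G (at p q v (γ + k) l c) →
          HasFlow (attach G p q) (at zero (suc p) (suc v) α γ c)
  grow⁺ {G} {p} {q} {v} {α} {γ} {c} k l qk ql k+l≡α φ =
    attach⁺ k l qk ql (trans k+l≡α (sym (at-new p v α γ c)))
      (flow-resp (λ w → sym (at-old p q v k l α γ c w)) φ)

  grow⁻ : ∀ {G} {p q v : Vertex G} {α γ c} →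
          HasFlow (attach G p q) (at zero (suc p) (suc v) α γ c) →
          ∃[ k ] ∃[ l ] Q k × Q l × k + l ≡ α × HasFlow G (at p q v (γ + k) l c)
  grow⁻ {G} {p} {q} {v} {α} {γ} {c} φ with k , l , qk , ql , k+l≡ , φ′ ← attach⁻ φ =
    k , l , qk , ql , trans k+l≡ (at-new p v α γ c) , flow-resp (at-old p q v k l α γ c) φ′

  -- If the chord carries `a` from the new vertex to `v`, the rest of the graph has to carry `a`
  -- back, with boundary 0 everywhere else.
  close⁺ : ∀ {G} {p q v : Vertex G} {0≢v : zero ≢ suc v} a → Q a →
           HasFlow (attach G p q) (at zero (suc p) (suc v) (- a) 0# a) →
           HasFlow (addEdge (attach G p q) zero (suc v) 0≢v) (λ _ → 0#)
  close⁺ {G} {p} {q} {v} {0≢v} a qa φ =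
    addEdge⁺ {attach G p q} {x≢y = 0≢v} a qa (flow-resp (λ w → sym (at-chord p v a w)) φ)

  close⁻ : ∀ {G} {p q v : Vertex G} {0≢v : zero ≢ suc v} →
           HasFlow (addEdge (attach G p q) zero (suc v) 0≢v) (λ _ → 0#) →
           ∃[ a ] Q a × HasFlow (attach G p q) (at zero (suc p) (suc v) (- a) 0# a)
  close⁻ {G} {p} {q} {v} {0≢v} φ with a , qa , φ′ ← addEdge⁻ {attach G p q} {x≢y = 0≢v} φ =
    a , qa , flow-resp (at-chord p v a) φ′

-- Flows modulo 3 and over the integers

open import Data.Integer.Base using (ℤ; +_; 0ℤ; _-_; -_) renaming (_+_ to _+ℤ_)

infixl 6 _⊕_
infix  8 ⊖_

-- Since ℤ₃ is given by tables, its laws and the finite lemmas below can be proved by exhaustive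
-- checks.
_⊕_ : Fin 3 → Fin 3 → Fin 3
0F ⊕ y  = y
1F ⊕ 0F = 1F
1F ⊕ 1F = 2F
1F ⊕ 2F = 0F
2F ⊕ 0F = 2F
2F ⊕ 1F = 0F
2F ⊕ 2F = 1F

⊖_ : Fin 3 → Fin 3
⊖ 0F = 0F
⊖ 1F = 2F
⊖ 2F = 1F

⊕-isAbelianGroup : IsAbelianGroup _≡_ _⊕_ 0F ⊖_
⊕-isAbelianGroup = record
  { isGroup = record
    { isMonoid = record
      { isSemigroup = record
        { isMagma = isMagma _⊕_
        ; assoc   = from-yes (all? λ x → all? λ y → all? λ z → (x ⊕ y) ⊕ z ≟ x ⊕ (y ⊕ z))
        }
      ; identity = (λ _ → refl) , from-yes (all? λ x → x ⊕ 0F ≟ x)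
      }
    ; inverse = from-yes (all? λ x → ⊖ x ⊕ x ≟ 0F) , from-yes (all? λ x → x ⊕ ⊖ x ≟ 0F)
    ; ⁻¹-cong = cong ⊖_
    }
  ; comm = from-yes (all? λ x → all? λ y → x ⊕ y ≟ y ⊕ x)
  }

⊖-nonzero : ∀ {x} → x ≢ 0F → ⊖ x ≢ 0F
⊖-nonzero {0F} x≢0 = x≢0
⊖-nonzero {1F} _ ()
⊖-nonzero {2F} _ ()

Small : ℤ → Set
Small a = a ∈ (+ 1 ∷ - + 1 ∷ + 2 ∷ - + 2 ∷ [])

pattern is1  = here refl
pattern is-1 = there (here refl)
pattern is2  = there (there (here refl))
pattern is-2 = there (there (there (here refl)))

Small-neg : ∀ {a} → Small a → Small (- a)
Small-neg is1  = is-1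
Small-neg is-1 = is1
Small-neg is2  = is-2
Small-neg is-2 = is2

module F₃ = Flow ⊕-isAbelianGroup (_≢ 0F) ⊖-nonzero
module Fℤ = Flow +-0-isAbelianGroup Small Small-neg

-- A record, because a bare congruence unfolds to a divisibility from which `a` and `x` cannot be
-- inferred.
record Residue (a : ℤ) (x : Fin 3) : Set where
  constructor residue
  field congruent : a ≡ + toℕ x [mod-3]

residue-toℕ : ∀ x → Residue (+ toℕ x) x
residue-toℕ x = residue (self x)
  where
  self : ∀ x → + toℕ x ≡ + toℕ x [mod-3]
  self = from-yes (all? λ (x : Fin 3) → + 3 ∣ℤ? (+ toℕ x - + toℕ x))

residue-+ : ∀ {a b x y} → Residue a x → Residue b y → Residue (a +ℤ b) (x ⊕ y)
residue-+ {a} {b} {x} {y} (residue ax) (residue by) = residue (subst (+ 3 ∣ℤ_)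
  (solve 5 (λ a b x y z → ((a :- x) :+ (b :- y)) :+ ((x :+ y) :- z) := (a :+ b) :- z) refl
    a b (+ toℕ x) (+ toℕ y) (+ toℕ (x ⊕ y)))
  (∣ℤ-+ (∣ℤ-+ ax by) (carry x y)))
  where
  open +-*-Solver
  carry : ∀ x y → + 3 ∣ℤ ((+ toℕ x +ℤ + toℕ y) - + toℕ (x ⊕ y))
  carry = from-yes (all? λ x → all? λ y → + 3 ∣ℤ? ((+ toℕ x +ℤ + toℕ y) - + toℕ (x ⊕ y)))

residue-neg : ∀ {a x} → Residue a x → Residue (- a) (⊖ x)
residue-neg {a} {x} (residue ax) = residue (subst (+ 3 ∣ℤ_)
  (solve 3 (λ a x z → (:- (a :- x)) :+ (:- x :- z) := :- a :- z) refl a (+ toℕ x) (+ toℕ (⊖ x)))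
  (∣ℤ-+ (∣ℤ-neg ax) (carry x)))
  where
  open +-*-Solver
  carry : ∀ x → + 3 ∣ℤ (- + toℕ x - + toℕ (⊖ x))
  carry = from-yes (all? λ x → + 3 ∣ℤ? (- + toℕ x - + toℕ (⊖ x)))

residue-unique : ∀ {a x y} → Residue a x → Residue a y → x ≡ y
residue-unique {a} {x} {y} (residue ax) (residue ay) = distinct x y (subst (+ 3 ∣ℤ_)
  (solve 3 (λ a x y → (:- (a :- x)) :+ (a :- y) := x :- y) refl a (+ toℕ x) (+ toℕ y))
  (∣ℤ-+ (∣ℤ-neg ax) ay))
  where
  open +-*-Solver
  distinct : ∀ x y → + 3 ∣ℤ (+ toℕ x - + toℕ y) → x ≡ y
  distinct = from-yes (all? λ (x : Fin 3) → all? λ (y : Fin 3) → (+ 3 ∣ℤ? (+ toℕ x - + toℕ y)) →-dec (x ≟ y))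

residue-∑ℤ : ∀ {n} {g : Fin n → ℤ} {h} → (∀ i → Residue (g i) (h i)) → Residue (∑ℤ g) (F₃.sum h)
residue-∑ℤ {ℕ.zero}  _ = residue-toℕ 0F
residue-∑ℤ {ℕ.suc n} r = residue-+ (r zero) (residue-∑ℤ (r ∘ suc))

residue-∑ℕ : ∀ {n} {g : Fin n → ℕ} {h} → (∀ i → Residue (+ g i) (h i)) → Residue (+ ∑ℕ g) (F₃.sum h)
residue-∑ℕ {ℕ.zero}  _ = residue-toℕ 0F
residue-∑ℕ {ℕ.suc n} r = residue-+ (r zero) (residue-∑ℕ (r ∘ suc))

-- The values carry signs, so every edge may simply be directed from `end₁` to `end₂`.
integral⇒HasNowhereZero3Flow : ∀ {G} → Fℤ.HasFlow G (λ _ → 0ℤ) → HasNowhereZero3Flow G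
integral⇒HasNowhereZero3Flow {G} (Fℤ.flow f q ∂f≡) =
  D , f , q , λ v → i-j≡0⇒i≡j (outFlow G D f v) (inFlow G D f v) (trans (sym (Fℤ.∂-orientation G D f v)) (∂f≡ v))
  where
  D : Orientation G
  D _ = true

Small-residue : ∀ {a} → Small a → ∃[ x ] x ≢ 0F × Residue a x
Small-residue is1  = 1F , (λ ()) , residue (from-yes (+ 3 ∣ℤ? (+ 1 - + 1)))
Small-residue is-1 = 2F , (λ ()) , residue (from-yes (+ 3 ∣ℤ? (- + 1 - + 2)))
Small-residue is2  = 2F , (λ ()) , residue (from-yes (+ 3 ∣ℤ? (+ 2 - + 2)))
Small-residue is-2 = 1F , (λ ()) , residue (from-yes (+ 3 ∣ℤ? (- + 2 - + 1)))

signed : Bool → Fin 3 → Fin 3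
signed b x = if b then x else ⊖ x

signed-nonzero : ∀ b {x} → x ≢ 0F → signed b x ≢ 0F
signed-nonzero true  x≢0 = x≢0
signed-nonzero false x≢0 = ⊖-nonzero x≢0

residue-if : ∀ (b : Bool) {a x} → Residue a x → Residue (if b then a else 0ℤ) (if b then x else 0F)
residue-if true  r = r
residue-if false r = residue-toℕ 0F

residue-indicator : ∀ (b : Bool) → Residue (+ (if b then 1 else 0)) (if b then 1F else 0F)
residue-indicator true  = residue-toℕ 1F
residue-indicator false = residue-toℕ 0F

residue-degrees : ∀ G (D : Orientation G) v →
  Residue (+ outDegree G D v - + inDegree G D v) (F₃.∂ G (λ e → signed (D e) 1F) v)
residue-degrees G D v = subst (Residue (+ outDegree G D v - + inDegree G D v))
  (sym (F₃.∂-orientation G D (λ _ → 1F) v))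
  (residue-+ (residue-∑ℕ λ e → residue-indicator (does (tail G D e ≟ v)))
    (residue-neg (residue-∑ℕ λ e → residue-indicator (does (head G D e ≟ v)))))

-- None of ±1, ±2 is divisible by 3, so reduction keeps the values nonzero. Hence a nowhere-zero
-- 3-flow can be excluded modulo 3.
HasNowhereZero3Flow⇒mod3 : ∀ {G} → HasNowhereZero3Flow G → F₃.HasFlow G (λ _ → 0F)
HasNowhereZero3Flow⇒mod3 {G} (D , f , small , balanced) =
  F₃.flow (λ e → signed (D e) (h e)) (λ e → signed-nonzero (D e) (proj₁ (proj₂ (Small-residue (small e)))))
    λ v → residue-unique
      (subst (Residue (outFlow G D f v - inFlow G D f v)) (sym (F₃.∂-orientation G D h v))
        (residue-+ (residue-∑ℤ λ e → residue-if (does (tail G D e ≟ v)) (f-h e))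
          (residue-neg (residue-∑ℤ λ e → residue-if (does (head G D e ≟ v)) (f-h e)))))
      (subst (λ a → Residue a 0F) (sym (i≡j⇒i-j≡0 {outFlow G D f v} (balanced v))) (residue-toℕ 0F))
  where
  h : Edge G → Fin 3
  h e = proj₁ (Small-residue (small e))
  f-h : ∀ e → Residue (f e) (h e)
  f-h e = proj₂ (proj₂ (Small-residue (small e)))

-- The nonzero elements of ℤ₃ are 1 and -1, so a nonzero value on every edge is the same as an
-- orientation; this is ℤ₃-connectivity in terms of flows.
Mod3-Connected : Graph → Set
Mod3-Connected G = ∀ (β : Vertex G → Fin 3) → F₃.sum β ≡ 0F → F₃.HasFlow G β

mod3-boundary : ∀ {G} {β : Vertex G → Fin 3} → F₃.sum β ≡ 0F → IsBoundary G β
mod3-boundary {β = β} ∑β≡0 = ∣⇒∣ᵤ (subst (+ 3 ∣ℤ_) (+-identityʳ (+ ∑ℕ (toℕ ∘ β)))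
  (Residue.congruent (subst (Residue (+ ∑ℕ (toℕ ∘ β))) ∑β≡0 (residue-∑ℕ (residue-toℕ ∘ β)))))

boundary-mod3 : ∀ {G} {β : Vertex G → Fin 3} → IsBoundary G β → F₃.sum β ≡ 0F
boundary-mod3 {β = β} 3∣∑β = residue-unique (residue-∑ℕ (residue-toℕ ∘ β))
  (residue (subst (+ 3 ∣ℤ_) (sym (+-identityʳ (+ ∑ℕ (toℕ ∘ β)))) (∣ᵤ⇒∣ 3∣∑β)))

ℤ₃-Connected⇒Mod3 : ∀ {G} → ℤ₃-Connected G → Mod3-Connected G
ℤ₃-Connected⇒Mod3 {G} conn β ∑β≡0 with D , D-β ← conn β (mod3-boundary {G} ∑β≡0) =
  F₃.flow (λ e → signed (D e) 1F) (λ e → signed-nonzero (D e) λ ())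
    λ v → residue-unique (residue-degrees G D v) (residue (D-β v))

Mod3⇒ℤ₃-Connected : ∀ {G} → Mod3-Connected G → ℤ₃-Connected G
Mod3⇒ℤ₃-Connected {G} conn β 3∣∑β with F₃.flow f q ∂f≡ ← conn β (boundary-mod3 {G} 3∣∑β) =
  D , λ v → Residue.congruent (subst (Residue (+ outDegree G D v - + inDegree G D v))
    (trans (F₃.∂-cong G signed-f v) (∂f≡ v)) (residue-degrees G D v))
  where
  D : Orientation G
  -- The value 2 is -1, that is, one unit from `end₂` to `end₁`.
  D e = does (f e ≟ 1F)

  signed-≟ : ∀ x → x ≢ 0F → signed (does (x ≟ 1F)) 1F ≡ x
  signed-≟ 0F x≢0 = contradiction refl x≢0
  signed-≟ 1F _   = refl
  signed-≟ 2F _   = refl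

  signed-f : ∀ e → signed (D e) 1F ≡ f e
  signed-f e = signed-≟ (f e) (q e)

-- Isomorphisms and triangle-trees

infixl 9 _·_

_·_ : G ≅ H → Vertex G → Vertex H
i · v = _≅_.vertices i ⟨$⟩ʳ v

·-injective : (i : G ≅ H) {u v : Vertex G} → i · u ≡ i · v → u ≡ v
·-injective i = permutation-injective (_≅_.vertices i)

joins-map : ∀ {A B : Set} (f : A → B) {a b x y : A} {u v : B} →
            (a ≡ x × b ≡ y) ⊎ (a ≡ y × b ≡ x) → (u ≡ f a × v ≡ f b) ⊎ (u ≡ f b × v ≡ f a) →
            (u ≡ f x × v ≡ f y) ⊎ (u ≡ f y × v ≡ f x)
joins-map f (inj₁ (refl , refl)) j = j
joins-map f (inj₂ (refl , refl)) j = swap j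

≅-refl : G ≅ G
≅-refl = record { vertices = Perm.id ; edges = Perm.id ; ends = λ _ → inj₁ (refl , refl) }

≅-sym : G ≅ H → H ≅ G
≅-sym {G} {H} i = record
  { vertices = Perm.flip vertices
  ; edges    = Perm.flip edges
  ; ends     = λ e → back (flip-≅ i e)
  }
  where
  open _≅_ i
  back : ∀ {x y a b} → (x ≡ vertices ⟨$⟩ʳ a × y ≡ vertices ⟨$⟩ʳ b) ⊎ (x ≡ vertices ⟨$⟩ʳ b × y ≡ vertices ⟨$⟩ʳ a) →
         (a ≡ vertices ⟨$⟩ˡ x × b ≡ vertices ⟨$⟩ˡ y) ⊎ (a ≡ vertices ⟨$⟩ˡ y × b ≡ vertices ⟨$⟩ˡ x)
  back (inj₁ (refl , refl)) = inj₁ (sym (Perm.inverseˡ vertices) , sym (Perm.inverseˡ vertices))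
  back (inj₂ (refl , refl)) = inj₂ (sym (Perm.inverseˡ vertices) , sym (Perm.inverseˡ vertices))

≅-trans : G ≅ H → H ≅ K → G ≅ K
≅-trans i j = record
  { vertices = _≅_.vertices i Perm.∘ₚ _≅_.vertices j
  ; edges    = _≅_.edges i Perm.∘ₚ _≅_.edges j
  ; ends     = λ e → joins-map (j ·_) (_≅_.ends i e) (_≅_.ends j _)
  }

·-sym-· : (i : G ≅ H) (v : Vertex H) → i · (≅-sym i · v) ≡ v
·-sym-· i v = Perm.inverseʳ (_≅_.vertices i)

adjacent-map : (i : G ≅ H) {x y : Vertex G} → Adjacent G x y → Adjacent H (i · x) (i · y)
adjacent-map i (e , j) = _≅_.edges i ⟨$⟩ʳ e , joins-map (i ·_) j (_≅_.ends i e)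

adjacent-sym : ∀ G {x y} → Adjacent G x y → Adjacent G y x
adjacent-sym G (e , j) = e , swap j

adjacent⇒≢ : ∀ G {x y} → Adjacent G x y → x ≢ y
adjacent⇒≢ G (e , inj₁ (refl , refl)) x≡y = loopless G e x≡y
adjacent⇒≢ G (e , inj₂ (refl , refl)) x≡y = loopless G e (sym x≡y)

degree-map : (i : G ≅ H) (v : Vertex G) → degree H (i · v) ≡ degree G v
degree-map {G} {H} i v = trans
  (∑ℕ-cong {∣E∣ H} λ e → cong (if_then 1 else 0) (term (flip-≅ i e)))
  (sym (∑ℕ-permute _ (Perm.flip edges)))
  where
  open _≅_ i
  open Sum ℕ-+-0 using () renaming (sum-cong-≗ to ∑ℕ-cong; sum-permute to ∑ℕ-permute)
  term : ∀ {x y a b} → (x ≡ i · a × y ≡ i · b) ⊎ (x ≡ i · b × y ≡ i · a) →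
         does (x ≟ i · v) ∨ does (y ≟ i · v) ≡ does (a ≟ v) ∨ does (b ≟ v)
  term (inj₁ (refl , refl)) = cong₂ _∨_ (does-permute vertices _ v) (does-permute vertices _ v)
  term {a = a} {b} (inj₂ (refl , refl)) = trans
    (cong₂ _∨_ (does-permute vertices _ v) (does-permute vertices _ v)) (∨-comm (does (b ≟ v)) (does (a ≟ v)))

attach-cong : (i : G ≅ H) {y z : Vertex G} → attach G y z ≅ attach H (i · y) (i · z)
attach-cong {G} {H} i {y} {z} = record
  { vertices = Perm.lift₀ (_≅_.vertices i)
  ; edges    = Perm.lift₀ (Perm.lift₀ (_≅_.edges i))
  ; ends     = λ { zero          → inj₁ (refl , refl)
                 ; (suc zero)    → inj₁ (refl , refl)
                 ; (suc (suc e)) → suc-joins (_≅_.ends i e) }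
  }
  where
  suc-joins : ∀ {n} {a b x y : Fin n} → (a ≡ x × b ≡ y) ⊎ (a ≡ y × b ≡ x) →
              (suc a ≡ suc x × suc b ≡ suc y) ⊎ (suc a ≡ suc y × suc b ≡ suc x)
  suc-joins (inj₁ (refl , refl)) = inj₁ (refl , refl)
  suc-joins (inj₂ (refl , refl)) = inj₂ (refl , refl)

attach-swap : ∀ {y z : Vertex G} → attach G y z ≅ attach G z y
attach-swap = record
  { vertices = Perm.id
  ; edges    = Perm.swap Perm.id
  ; ends     = λ { zero          → inj₁ (refl , refl)
                 ; (suc zero)    → inj₁ (refl , refl)
                 ; (suc (suc e)) → inj₁ (refl , refl) }
  }

-- Two attachments to edges of the same old graph are independent; this lets a strip be altered at
-- one end after it has grown at the other.
attach-comm : ∀ {a b c d : Vertex G} →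
              attach (attach G a b) (suc c) (suc d) ≅ attach (attach G c d) (suc a) (suc b)
attach-comm = record
  { vertices = Perm.swap Perm.id
  ; edges    = Perm.permutation exchange exchange involutive involutive
  ; ends     = λ { zero                      → inj₁ (refl , refl)
                 ; (suc zero)                → inj₁ (refl , refl)
                 ; (suc (suc zero))          → inj₁ (refl , refl)
                 ; (suc (suc (suc zero)))    → inj₁ (refl , refl)
                 ; (suc (suc (suc (suc e)))) → inj₁ (refl , refl) }
  }
  where
  exchange : ∀ {n} → Fin (ℕ.suc (ℕ.suc (ℕ.suc (ℕ.suc n)))) → Fin (ℕ.suc (ℕ.suc (ℕ.suc (ℕ.suc n))))
  exchange zero                      = suc (suc zero)
  exchange (suc zero)                = suc (suc (suc zero))
  exchange (suc (suc zero))          = zero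
  exchange (suc (suc (suc zero)))    = suc zero
  exchange (suc (suc (suc (suc e)))) = suc (suc (suc (suc e)))

  involutive : ∀ {n} (e : Fin (ℕ.suc (ℕ.suc (ℕ.suc (ℕ.suc n))))) → exchange (exchange e) ≡ e
  involutive zero                      = refl
  involutive (suc zero)                = refl
  involutive (suc (suc zero))          = refl
  involutive (suc (suc (suc zero)))    = refl
  involutive (suc (suc (suc (suc e)))) = refl

addEdge-cong : (i : G ≅ H) {x y : Vertex G} (x≢y : x ≢ y) (φx≢φy : i · x ≢ i · y) →
               addEdge G x y x≢y ≅ addEdge H (i · x) (i · y) φx≢φy
addEdge-cong i _ _ = record
  { vertices = _≅_.vertices i
  ; edges    = Perm.lift₀ (_≅_.edges i)
  ; ends     = λ { zero → inj₁ (refl , refl) ; (suc e) → _≅_.ends i e }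
  }

addEdge-swap : {x y : Vertex G} (x≢y : x ≢ y) (y≢x : y ≢ x) → addEdge G x y x≢y ≅ addEdge G y x y≢x
addEdge-swap _ _ = record
  { vertices = Perm.id
  ; edges    = Perm.id
  ; ends     = λ { zero → inj₂ (refl , refl) ; (suc e) → inj₁ (refl , refl) }
  }

colorable-map : G ≅ H → Vertex-3-Colorable G → Vertex-3-Colorable H
colorable-map i (c , proper) =
  c ∘ (≅-sym i ·_) , λ x y xy → proper _ _ (adjacent-map (≅-sym i) xy)

Mod3-Connected-map : G ≅ H → Mod3-Connected G → Mod3-Connected H
Mod3-Connected-map i conn β ∑β≡0 =
  F₃.transport i (conn (β ∘ (i ·_)) (trans (sym (F₃.sum-permute β (_≅_.vertices i))) ∑β≡0))

attach-old : ∀ {y z a b : Vertex G} → Adjacent (attach G y z) (suc a) (suc b) → Adjacent G a b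
attach-old (zero , inj₁ (() , _))
attach-old (zero , inj₂ (() , _))
attach-old (suc zero , inj₁ (() , _))
attach-old (suc zero , inj₂ (() , _))
attach-old (suc (suc e) , inj₁ (p , q)) = e , inj₁ (suc-injective p , suc-injective q)
attach-old (suc (suc e) , inj₂ (p , q)) = e , inj₂ (suc-injective p , suc-injective q)

attach-new : ∀ {y z b : Vertex G} → Adjacent (attach G y z) zero (suc b) → b ≡ y ⊎ b ≡ z
attach-new (zero , inj₁ (_ , q)) = inj₁ (sym (suc-injective q))
attach-new (suc zero , inj₁ (_ , q)) = inj₂ (sym (suc-injective q))
attach-new (zero , inj₂ (() , _))
attach-new (suc zero , inj₂ (() , _))
attach-new (suc (suc e) , inj₁ (() , _))
attach-new (suc (suc e) , inj₂ (_ , ()))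

-- Triangle-trees in the numbering of their construction, with the newest vertex 0. Induction can
-- then remove the newest vertex directly; `normalise` reduces the general case to this one.
data Tree : Graph → Set where
  base   : Tree triangle
  extend : ∀ {G} {y z : Vertex G} → Tree G → Adjacent G y z → Tree (attach G y z)

normalise : TriangleTree G → Σ[ T ∈ Graph ] Tree T × T ≅ G
normalise base = triangle , base , ≅-refl
normalise (extend t yz) with T , t′ , i ← normalise t =
  -- Using `attach-cong` for the inverse isomorphism makes `y` and `z` appear literally, rather than
  -- as images of their preimages.
  _ , extend t′ (adjacent-map (≅-sym i) yz) , ≅-sym (attach-cong (≅-sym i))
normalise (relabel t j) with T , t′ , i ← normalise t = T , t′ , ≅-trans i j

Proper : (G : Graph) → (Vertex G → Fin 3) → Set
Proper G c = ∀ x y → Adjacent G x y → c x ≢ c y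

tree-colorable : Tree G → Vertex-3-Colorable G
tree-colorable base = id , λ x y → adjacent⇒≢ triangle
tree-colorable (extend {G} {y} {z} t yz) with c , proper ← tree-colorable t = c′ , proper′
  where
  c′ : Vertex (attach G y z) → Fin 3
  -- All three colours sum to 0, so the colour missing from an edge is minus the sum of the colours
  -- of its ends.
  c′ zero    = ⊖ (c y ⊕ c z)
  c′ (suc v) = c v

  third : ∀ a b → a ≢ b → ⊖ (a ⊕ b) ≢ a × ⊖ (a ⊕ b) ≢ b
  third = from-yes (all? λ a → all? λ b → ¬? (a ≟ b) →-dec
    (¬? (⊖ (a ⊕ b) ≟ a) ×-dec ¬? (⊖ (a ⊕ b) ≟ b)))

  new : ∀ v → Adjacent (attach G y z) zero (suc v) → c′ zero ≢ c v
  new v 0v with attach-new {y = y} {z} 0v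
  ... | inj₁ refl = proj₁ (third _ _ (proper _ _ yz))
  ... | inj₂ refl = proj₂ (third _ _ (proper _ _ yz))

  proper′ : Proper (attach G y z) c′
  proper′ zero    zero    0v = contradiction refl (adjacent⇒≢ (attach G y z) 0v)
  proper′ zero    (suc v) 0v = new v 0v
  proper′ (suc u) zero    u0 = new u (adjacent-sym (attach G y z) u0) ∘ sym
  proper′ (suc u) (suc v) uv = proper u v (attach-old {y = y} {z} uv)

-- Boundaries modulo 3 on triangle-trees

infixl 7 _⊗_

_⊗_ : Fin 3 → Fin 3 → Fin 3
0F ⊗ y = 0F
1F ⊗ y = y
2F ⊗ y = ⊖ y

⊗-distribˡ-⊕ : ∀ x y z → x ⊗ (y ⊕ z) ≡ x ⊗ y ⊕ x ⊗ z
⊗-distribˡ-⊕ = from-yes (all? λ x → all? λ y → all? λ z → x ⊗ (y ⊕ z) ≟ x ⊗ y ⊕ x ⊗ z)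

⊗-zeroʳ : ∀ x → x ⊗ 0F ≡ 0F
⊗-zeroʳ = from-yes (all? λ x → x ⊗ 0F ≟ 0F)

⟨_,_⟩ : ∀ {n} → (Fin n → Fin 3) → (Fin n → Fin 3) → Fin 3
⟨ c , β ⟩ = F₃.sum (λ v → c v ⊗ β v)

⟨,⟩-⊕ : ∀ {n} (c β γ : Fin n → Fin 3) → ⟨ c , (λ v → β v ⊕ γ v) ⟩ ≡ ⟨ c , β ⟩ ⊕ ⟨ c , γ ⟩
⟨,⟩-⊕ {n} c β γ = trans (F₃.sum-cong-≗ {n} λ v → ⊗-distribˡ-⊕ (c v) (β v) (γ v)) (F₃.∑-distrib-+ {n} _ _)

⟨,⟩-δ : ∀ {n} (c : Fin n → Fin 3) i a → ⟨ c , F₃.δ i a ⟩ ≡ c i ⊗ a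
⟨,⟩-δ {ℕ.suc n} c zero a = trans
  (cong (c zero ⊗ a ⊕_) (trans (F₃.sum-cong-≗ {n} (⊗-zeroʳ ∘ c ∘ suc)) (F₃.sum-replicate-zero n)))
  (proj₂ (IsAbelianGroup.identity ⊕-isAbelianGroup) _)
⟨,⟩-δ c (suc i) a = trans (cong (_⊕ ⟨ c ∘ suc , F₃.δ i a ⟩) (⊗-zeroʳ (c zero))) (⟨,⟩-δ (c ∘ suc) i a)

⟨,⟩-shift : ∀ {n} (c β : Fin n → Fin 3) y a z b →
            ⟨ c , (λ w → (β w ⊕ F₃.δ y a w) ⊕ F₃.δ z b w) ⟩ ≡ (⟨ c , β ⟩ ⊕ c y ⊗ a) ⊕ c z ⊗ b
⟨,⟩-shift c β y a z b =
  trans (⟨,⟩-⊕ c (λ w → β w ⊕ F₃.δ y a w) (F₃.δ z b))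
    (cong₂ _⊕_ (trans (⟨,⟩-⊕ c β (F₃.δ y a)) (cong (⟨ c , β ⟩ ⊕_) (⟨,⟩-δ c y a))) (⟨,⟩-δ c z b))

∑-shift : ∀ {n} (β : Fin n → Fin 3) y a z b →
          F₃.sum (λ w → (β w ⊕ F₃.δ y a w) ⊕ F₃.δ z b w) ≡ (F₃.sum β ⊕ a) ⊕ b
∑-shift = ⟨,⟩-shift (λ _ → 1F)

triple : Fin 3 → Fin 3 → Fin 3 → Fin 3 → Fin 3
triple x y z 0F = x
triple x y z 1F = y
triple x y z 2F = z

Distinct : Fin 3 → Fin 3 → Fin 3 → Set
Distinct x y z = x ≢ y × x ≢ z × y ≢ z

distinct? : ∀ x y z → Dec (Distinct x y z)
distinct? x y z = ¬? (x ≟ y) ×-dec ¬? (x ≟ z) ×-dec ¬? (y ≟ z)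

proper-triangle : ∀ {c} → Proper triangle c → Distinct (c 0F) (c 1F) (c 2F)
proper-triangle proper =
  proper 0F 1F (0F , inj₁ (refl , refl)) ,
  proper 0F 2F (2F , inj₁ (refl , refl)) ,
  proper 1F 2F (1F , inj₁ (refl , refl))

proper-attach : ∀ {G y z c} → Proper (attach G y z) c → Adjacent G y z →
                Proper G (c ∘ suc) × Distinct (c zero) (c (suc y)) (c (suc z))
proper-attach {G} {y} {z} proper (e , yz) =
  (λ u v (d , uv) → proper (suc u) (suc v) (suc (suc d) , lift uv)) ,
  proper zero (suc y) (0F , inj₁ (refl , refl)) ,
  proper zero (suc z) (1F , inj₁ (refl , refl)) ,
  proper (suc y) (suc z) (suc (suc e) , lift yz)
  where
  lift : ∀ {e u v} → Joins G e u v → Joins (attach G y z) (suc (suc e)) (suc u) (suc v)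
  lift (inj₁ (refl , refl)) = inj₁ (refl , refl)
  lift (inj₂ (refl , refl)) = inj₂ (refl , refl)

-- Three distinct colours sum to 0.
dot-constant : ∀ x₀ x₁ x₂ b → Distinct x₀ x₁ x₂ → x₀ ⊗ b ⊕ (x₁ ⊗ b ⊕ (x₂ ⊗ b ⊕ 0F)) ≡ 0F
dot-constant = from-yes (all? λ x₀ → all? λ x₁ → all? λ x₂ → all? λ b →
  distinct? x₀ x₁ x₂ →-dec (x₀ ⊗ b ⊕ (x₁ ⊗ b ⊕ (x₂ ⊗ b ⊕ 0F)) ≟ 0F))

last-value : ∀ b₀ b₁ b₂ → b₀ ⊕ (b₁ ⊕ (b₂ ⊕ 0F)) ≡ 0F → b₂ ≡ ⊖ (b₀ ⊕ b₁)
last-value = from-yes (all? λ b₀ → all? λ b₁ → all? λ b₂ →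
  (b₀ ⊕ (b₁ ⊕ (b₂ ⊕ 0F)) ≟ 0F) →-dec (b₂ ≟ ⊖ (b₀ ⊕ b₁)))

-- The zero sum determines the third boundary value, so a table indexed by the first two suffices.
-- Its entries are the values on the edges 01, 12 and 02, each directed to its larger end.
nonconstant : ∀ b₀ b₁ b₂ → b₀ ⊕ (b₁ ⊕ (b₂ ⊕ 0F)) ≡ 0F → ¬ (b₀ ≡ b₁ × b₀ ≡ b₂) →
  ∃[ x ] ∃[ y ] ∃[ z ] x ≢ 0F × y ≢ 0F × z ≢ 0F × (∀ v → F₃.∂ triangle (triple x y z) v ≡ triple b₀ b₁ b₂ v)
nonconstant b₀ b₁ b₂ ∑≡0 = subst
  (λ b → ¬ (b₀ ≡ b₁ × b₀ ≡ b) → ∃[ x ] ∃[ y ] ∃[ z ] x ≢ 0F × y ≢ 0F × z ≢ 0F ×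
    (∀ v → F₃.∂ triangle (triple x y z) v ≡ triple b₀ b₁ b v))
  (sym (last-value b₀ b₁ b₂ ∑≡0)) (values b₀ b₁)
  where
  values : ∀ b₀ b₁ → let b₂ = ⊖ (b₀ ⊕ b₁) in ¬ (b₀ ≡ b₁ × b₀ ≡ b₂) →
    ∃[ x ] ∃[ y ] ∃[ z ] x ≢ 0F × y ≢ 0F × z ≢ 0F × (∀ v → F₃.∂ triangle (triple x y z) v ≡ triple b₀ b₁ b₂ v)
  values 0F 0F _ = 1F , 1F , 2F , (λ ()) , (λ ()) , (λ ()) , λ { 0F → refl ; 1F → refl ; 2F → refl }
  values 0F 1F _ = 1F , 2F , 2F , (λ ()) , (λ ()) , (λ ()) , λ { 0F → refl ; 1F → refl ; 2F → refl }
  values 0F 2F _ = 2F , 1F , 1F , (λ ()) , (λ ()) , (λ ()) , λ { 0F → refl ; 1F → refl ; 2F → refl }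
  values 1F 0F _ = 2F , 2F , 2F , (λ ()) , (λ ()) , (λ ()) , λ { 0F → refl ; 1F → refl ; 2F → refl }
  values 1F 1F ≢const = contradiction (refl , refl) ≢const
  values 1F 2F _ = 2F , 1F , 2F , (λ ()) , (λ ()) , (λ ()) , λ { 0F → refl ; 1F → refl ; 2F → refl }
  values 2F 0F _ = 1F , 1F , 1F , (λ ()) , (λ ()) , (λ ()) , λ { 0F → refl ; 1F → refl ; 2F → refl }
  values 2F 1F _ = 1F , 2F , 1F , (λ ()) , (λ ()) , (λ ()) , λ { 0F → refl ; 1F → refl ; 2F → refl }
  values 2F 2F ≢const = contradiction (refl , refl) ≢const

triangle-reachable : ∀ c₀ c₁ c₂ b₀ b₁ b₂ → Distinct c₀ c₁ c₂ → b₀ ⊕ (b₁ ⊕ (b₂ ⊕ 0F)) ≡ 0F →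
  c₀ ⊗ b₀ ⊕ (c₁ ⊗ b₁ ⊕ (c₂ ⊗ b₂ ⊕ 0F)) ≢ 0F →
  ∃[ x ] ∃[ y ] ∃[ z ] x ≢ 0F × y ≢ 0F × z ≢ 0F × (∀ v → F₃.∂ triangle (triple x y z) v ≡ triple b₀ b₁ b₂ v)
triangle-reachable c₀ c₁ c₂ b₀ b₁ b₂ distinct ∑≡0 ≢0 = nonconstant b₀ b₁ b₂ ∑≡0
  λ { (refl , refl) → ≢0 (dot-constant c₀ c₁ c₂ b₀ distinct) }
-- Since n = -(y + z), the pairing is unchanged when the new vertex is removed with value -β₀ on
-- both its edges.
dot-residual : ∀ β₀ s n y z → Distinct n y z → n ⊗ β₀ ⊕ s ≡ (s ⊕ y ⊗ ⊖ β₀) ⊕ z ⊗ ⊖ β₀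
dot-residual = from-yes (all? λ β₀ → all? λ s → all? λ n → all? λ y → all? λ z →
  distinct? n y z →-dec (n ⊗ β₀ ⊕ s ≟ (s ⊕ y ⊗ ⊖ β₀) ⊕ z ⊗ ⊖ β₀))
-- If β₀ ≠ 0, the split into two copies of -β₀ preserves the pairing. If β₀ = 0, the splits 1 + 2
-- and 2 + 1 give pairings that differ by a nonzero multiple of y - z, so they do not both vanish.
split-boundary : ∀ β₀ s n y z → Distinct n y z → n ⊗ β₀ ⊕ s ≢ 0F →
                 ∃[ a ] ∃[ b ] a ≢ 0F × b ≢ 0F × a ⊕ b ≡ β₀ × (s ⊕ y ⊗ a) ⊕ z ⊗ b ≢ 0F
split-boundary β₀ s n y z distinct ≢0 with β₀ ≟ 0F
... | no β₀≢0 = ⊖ β₀ , ⊖ β₀ , ⊖-nonzero β₀≢0 , ⊖-nonzero β₀≢0 , double β₀ , ≢0 ∘ trans (dot-residual β₀ s n y z distinct)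
  where
  double : ∀ x → ⊖ x ⊕ ⊖ x ≡ x
  double = from-yes (all? λ x → ⊖ x ⊕ ⊖ x ≟ x)
... | yes refl with (s ⊕ y ⊗ 1F) ⊕ z ⊗ 2F ≟ 0F
...   | no ≢0₁  = 1F , 2F , (λ ()) , (λ ()) , refl , ≢0₁
...   | yes ≡0₁ = 2F , 1F , (λ ()) , (λ ()) , refl , λ ≡0₂ → proj₂ (proj₂ distinct) (both s y z ≡0₁ ≡0₂)
  where
  both : ∀ s y z → (s ⊕ y ⊗ 1F) ⊕ z ⊗ 2F ≡ 0F → (s ⊕ y ⊗ 2F) ⊕ z ⊗ 1F ≡ 0F → y ≡ z
  both = from-yes (all? λ s → all? λ y → all? λ z →
    ((s ⊕ y ⊗ 1F) ⊕ z ⊗ 2F ≟ 0F) →-dec ((s ⊕ y ⊗ 2F) ⊕ z ⊗ 1F ≟ 0F) →-dec (y ≟ z))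

split-sum : ∀ β₀ s a b → a ⊕ b ≡ β₀ → β₀ ⊕ s ≡ 0F → (s ⊕ a) ⊕ b ≡ 0F
split-sum = from-yes (all? λ β₀ → all? λ s → all? λ a → all? λ b →
  (a ⊕ b ≟ β₀) →-dec (β₀ ⊕ s ≟ 0F) →-dec ((s ⊕ a) ⊕ b ≟ 0F))

-- Zero sum and nonzero pairing with the colouring both survive the removal of the newest vertex,
-- provided that its boundary is split suitably. On the triangle, a nonzero pairing rules out the
-- constant boundaries.
mod3-reachable : ∀ {G c β} → Tree G → Proper G c → F₃.sum β ≡ 0F → ⟨ c , β ⟩ ≢ 0F → F₃.HasFlow G β
mod3-reachable {c = c} {β} base proper ∑β≡0 cβ≢0
  with x , y , z , x≢0 , y≢0 , z≢0 , ∂≡ ← triangle-reachable (c 0F) (c 1F) (c 2F)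
    (β 0F) (β 1F) (β 2F) (proper-triangle {c} proper) ∑β≡0 cβ≢0 =
  F₃.flow (triple x y z) (λ { 0F → x≢0 ; 1F → y≢0 ; 2F → z≢0 })
    λ { 0F → ∂≡ 0F ; 1F → ∂≡ 1F ; 2F → ∂≡ 2F }
mod3-reachable {c = c} {β} (extend {G} {y} {z} t yz) proper ∑β≡0 cβ≢0
  with proper′ , distinct ← proper-attach {c = c} proper yz
  with a , b , a≢0 , b≢0 , a+b≡ , ≢0 ←
    split-boundary (β zero) ⟨ c ∘ suc , β ∘ suc ⟩ (c zero) (c (suc y)) (c (suc z)) distinct cβ≢0 =
  F₃.attach⁺ a b a≢0 b≢0 a+b≡
    (mod3-reachable t proper′
      (trans (∑-shift (β ∘ suc) y a z b) (split-sum (β zero) (F₃.sum (β ∘ suc)) a b a+b≡ ∑β≡0))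
      (≢0 ∘ trans (sym (⟨,⟩-shift (c ∘ suc) (β ∘ suc) y a z b))))

-- Nonzero elements of ℤ₃ with nonzero sum are equal, and 2a = r means a = -r.
nonzero-sum : ∀ r a b → a ≢ 0F → b ≢ 0F → a ⊕ b ≡ r → r ≢ 0F → a ≡ ⊖ r × b ≡ ⊖ r
nonzero-sum = from-yes (all? λ r → all? λ a → all? λ b →
  ¬? (a ≟ 0F) →-dec ¬? (b ≟ 0F) →-dec (a ⊕ b ≟ r) →-dec ¬? (r ≟ 0F) →-dec ((a ≟ ⊖ r) ×-dec (b ≟ ⊖ r)))

attach-unreachable : ∀ {G y z} {β : Vertex (attach G y z) → Fin 3} → β zero ≢ 0F →
  ¬ F₃.HasFlow G (λ w → (β (suc w) ⊕ F₃.δ y (⊖ β zero) w) ⊕ F₃.δ z (⊖ β zero) w) →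
  ¬ F₃.HasFlow (attach G y z) β
attach-unreachable {G} {y} {z} {β} β₀≢0 unreachable φ
  with a , b , a≢0 , b≢0 , a+b≡ , φ′ ← F₃.attach⁻ φ
  with refl , refl ← nonzero-sum (β zero) a b a≢0 b≢0 a+b≡ β₀≢0 = unreachable φ′

-- Each vertex would have to send -r along both its edges, but the amounts that an edge carries away
-- from its two ends are opposite.
triangle-unreachable : ∀ {r} → r ≢ 0F → ¬ F₃.HasFlow triangle (λ _ → r)
triangle-unreachable {r} r≢0 (F₃.flow f f≢0 ∂f≡) =
  impossible (f 0F) (f 1F) (f 2F) r (f≢0 0F) (f≢0 1F) (f≢0 2F) r≢0 (∂f≡ 0F) (∂f≡ 1F) (∂f≡ 2F)
  where
  impossible : ∀ x y z r → x ≢ 0F → y ≢ 0F → z ≢ 0F → r ≢ 0F →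
    (x ⊕ 0F) ⊕ ((z ⊕ 0F) ⊕ 0F) ≡ r → ⊖ x ⊕ ((y ⊕ 0F) ⊕ 0F) ≡ r → ⊖ y ⊕ (⊖ z ⊕ 0F) ≢ r
  impossible = from-yes (all? λ x → all? λ y → all? λ z → all? λ r →
    ¬? (x ≟ 0F) →-dec ¬? (y ≟ 0F) →-dec ¬? (z ≟ 0F) →-dec ¬? (r ≟ 0F) →-dec
    ((x ⊕ 0F) ⊕ ((z ⊕ 0F) ⊕ 0F) ≟ r) →-dec (⊖ x ⊕ ((y ⊕ 0F) ⊕ 0F) ≟ r) →-dec ¬? (⊖ y ⊕ (⊖ z ⊕ 0F) ≟ r))

difference : ∀ b → ∃[ r ] r ≢ 0F × r ⊕ b ≢ 0F
difference = from-yes (all? λ b → any? λ r → ¬? (r ≟ 0F) ×-dec ¬? (r ⊕ b ≟ 0F))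

thirds : ∀ c₀ c₁ c₂ → Distinct c₀ c₁ c₂ → c₂ ≡ ⊖ (c₀ ⊕ c₁)
thirds = from-yes (all? λ c₀ → all? λ c₁ → all? λ c₂ → distinct? c₀ c₁ c₂ →-dec (c₂ ≟ ⊖ (c₀ ⊕ c₁)))

-- Zero sum and zero pairing are two independent conditions on three values, since the colours
-- differ; the constants are the line that remains.
triangle-constant : ∀ c₀ c₁ c₂ b₀ b₁ b₂ → Distinct c₀ c₁ c₂ → b₀ ⊕ (b₁ ⊕ (b₂ ⊕ 0F)) ≡ 0F →
                    c₀ ⊗ b₀ ⊕ (c₁ ⊗ b₁ ⊕ (c₂ ⊗ b₂ ⊕ 0F)) ≡ 0F → b₁ ≡ b₀ × b₂ ≡ b₀
triangle-constant c₀ c₁ c₂ b₀ b₁ b₂ distinct ∑≡0 dot≡0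
  rewrite thirds c₀ c₁ c₂ distinct | last-value b₀ b₁ b₂ ∑≡0 = equal c₀ c₁ b₀ b₁ (proj₁ distinct) dot≡0
  where
  equal : ∀ c₀ c₁ b₀ b₁ → c₀ ≢ c₁ →
          c₀ ⊗ b₀ ⊕ (c₁ ⊗ b₁ ⊕ (⊖ (c₀ ⊕ c₁) ⊗ ⊖ (b₀ ⊕ b₁) ⊕ 0F)) ≡ 0F → b₁ ≡ b₀ × ⊖ (b₀ ⊕ b₁) ≡ b₀
  equal = from-yes (all? λ c₀ → all? λ c₁ → all? λ b₀ → all? λ b₁ → ¬? (c₀ ≟ c₁) →-dec
    (c₀ ⊗ b₀ ⊕ (c₁ ⊗ b₁ ⊕ (⊖ (c₀ ⊕ c₁) ⊗ ⊖ (b₀ ⊕ b₁) ⊕ 0F)) ≟ 0F) →-dec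
    ((b₁ ≟ b₀) ×-dec (⊖ (b₀ ⊕ b₁) ≟ b₀)))

sum-residual : ∀ β₀ s → β₀ ⊕ s ≡ 0F → (s ⊕ ⊖ β₀) ⊕ ⊖ β₀ ≡ 0F
sum-residual = from-yes (all? λ β₀ → all? λ s → (β₀ ⊕ s ≟ 0F) →-dec ((s ⊕ ⊖ β₀) ⊕ ⊖ β₀ ≟ 0F))

-- Extend γ by r at the new vertex and add r at `y` and `z`: once the forced values -r on the new
-- edges are accounted for, γ remains on the old graph.
shift-cancel : ∀ {n} (y z : Fin n) r g w →
  (((g ⊕ F₃.δ y r w) ⊕ F₃.δ z r w) ⊕ F₃.δ y (⊖ r) w) ⊕ F₃.δ z (⊖ r) w ≡ g
shift-cancel y z r g w = cases (does (y ≟ w)) (does (z ≟ w)) r g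
  where
  cases : ∀ b b′ r g → (((g ⊕ (if b then r else 0F)) ⊕ (if b′ then r else 0F))
                          ⊕ (if b then ⊖ r else 0F)) ⊕ (if b′ then ⊖ r else 0F) ≡ g
  cases false false = from-yes (all? λ (r : Fin 3) → all? λ g → (((g ⊕ 0F) ⊕ 0F) ⊕ 0F) ⊕ 0F ≟ g)
  cases false true  = from-yes (all? λ r → all? λ g → (((g ⊕ 0F) ⊕ r) ⊕ 0F) ⊕ ⊖ r ≟ g)
  cases true  false = from-yes (all? λ r → all? λ g → (((g ⊕ r) ⊕ 0F) ⊕ ⊖ r) ⊕ 0F ≟ g)
  cases true  true  = from-yes (all? λ r → all? λ g → (((g ⊕ r) ⊕ r) ⊕ ⊖ r) ⊕ ⊖ r ≟ g)

-- The same extension of γ with β added: on the old graph there remains γ plus what β leaves when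
-- both new edges take the value -b.
shift-residual : ∀ {n} (y z : Fin n) r b g h w →
  ((((g ⊕ F₃.δ y r w) ⊕ F₃.δ z r w) ⊕ h) ⊕ F₃.δ y (⊖ (r ⊕ b)) w) ⊕ F₃.δ z (⊖ (r ⊕ b)) w ≡
  g ⊕ ((h ⊕ F₃.δ y (⊖ b) w) ⊕ F₃.δ z (⊖ b) w)
shift-residual y z r b g h w = cases (does (y ≟ w)) (does (z ≟ w)) r b g h
  where
  cases : ∀ t t′ r b g h →
    ((((g ⊕ (if t then r else 0F)) ⊕ (if t′ then r else 0F)) ⊕ h)
      ⊕ (if t then ⊖ (r ⊕ b) else 0F)) ⊕ (if t′ then ⊖ (r ⊕ b) else 0F) ≡
    g ⊕ ((h ⊕ (if t then ⊖ b else 0F)) ⊕ (if t′ then ⊖ b else 0F))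
  cases false false = from-yes (all? λ (r : Fin 3) → all? λ (b : Fin 3) → all? λ g → all? λ h →
    ((((g ⊕ 0F) ⊕ 0F) ⊕ h) ⊕ 0F) ⊕ 0F ≟ g ⊕ ((h ⊕ 0F) ⊕ 0F))
  cases false true  = from-yes (all? λ r → all? λ b → all? λ g → all? λ h →
    ((((g ⊕ 0F) ⊕ r) ⊕ h) ⊕ 0F) ⊕ ⊖ (r ⊕ b) ≟ g ⊕ ((h ⊕ 0F) ⊕ ⊖ b))
  cases true  false = from-yes (all? λ r → all? λ b → all? λ g → all? λ h →
    ((((g ⊕ r) ⊕ 0F) ⊕ h) ⊕ ⊖ (r ⊕ b)) ⊕ 0F ≟ g ⊕ ((h ⊕ ⊖ b) ⊕ 0F))
  cases true  true  = from-yes (all? λ r → all? λ b → all? λ g → all? λ h →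
    ((((g ⊕ r) ⊕ r) ⊕ h) ⊕ ⊖ (r ⊕ b)) ⊕ ⊖ (r ⊕ b) ≟ g ⊕ ((h ⊕ ⊖ b) ⊕ ⊖ b))

-- Since Σβ = 0 and c·β = 0, β is a combination of indicators of triangles; the coefficient
-- of each triangle is a difference of two nonzero elements, whence the two boundaries.
mod3-unreachable : ∀ {G c β} → Tree G → Proper G c → F₃.sum β ≡ 0F → ⟨ c , β ⟩ ≡ 0F →
  ∃[ γ ] F₃.sum γ ≡ 0F × ¬ F₃.HasFlow G γ × ¬ F₃.HasFlow G (λ v → γ v ⊕ β v)
mod3-unreachable {c = c} {β} base proper ∑β≡0 cβ≡0
  with r , r≢0 , r+b≢0 ← difference (β 0F)
  with p , q ← triangle-constant (c 0F) (c 1F) (c 2F) (β 0F) (β 1F) (β 2F) (proper-triangle {c} proper) ∑β≡0 cβ≡0 =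
  (λ _ → r) , thrice r , triangle-unreachable r≢0 ,
  triangle-unreachable r+b≢0 ∘ F₃.flow-resp λ { 0F → refl ; 1F → cong (r ⊕_) p ; 2F → cong (r ⊕_) q }
  where
  thrice : ∀ r → r ⊕ (r ⊕ (r ⊕ 0F)) ≡ 0F
  thrice = from-yes (all? λ r → r ⊕ (r ⊕ (r ⊕ 0F)) ≟ 0F)
mod3-unreachable {c = c} {β} (extend {G} {y} {z} t yz) proper ∑β≡0 cβ≡0 =
  let r , r≢0 , r+b≢0      = difference b
      proper′ , distinct   = proper-attach {c = c} proper yz
      γ , ∑γ≡0 , ¬γ , ¬γ+β = mod3-unreachable t proper′
        (trans (∑-shift (β ∘ suc) y (⊖ b) z (⊖ b)) (sum-residual b (F₃.sum (β ∘ suc)) ∑β≡0))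
        (trans (⟨,⟩-shift (c ∘ suc) (β ∘ suc) y (⊖ b) z (⊖ b))
          (trans (sym (dot-residual b ⟨ c ∘ suc , β ∘ suc ⟩ (c zero) (c (suc y)) (c (suc z)) distinct)) cβ≡0))
  in
  (λ { zero → r ; (suc w) → (γ w ⊕ F₃.δ y r w) ⊕ F₃.δ z r w }) ,
  trans (cong (r ⊕_) (trans (∑-shift γ y r z r) (cong (λ s → (s ⊕ r) ⊕ r) ∑γ≡0))) (thrice r) ,
  attach-unreachable r≢0 (¬γ ∘ F₃.flow-resp λ w → shift-cancel y z r (γ w) w) ,
  attach-unreachable r+b≢0 (¬γ+β ∘ F₃.flow-resp λ w → shift-residual y z r b (γ w) (β (suc w)) w)
  where
  b : Fin 3
  b = β zero

  thrice : ∀ r → r ⊕ ((0F ⊕ r) ⊕ r) ≡ 0F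
  thrice = from-yes (all? λ r → r ⊕ ((0F ⊕ r) ⊕ r) ≟ 0F)

-- The extra edge and 3-colourings

proper-addEdge : ∀ {G x y x≢y c} → Proper (addEdge G x y x≢y) c → Proper G c × c x ≢ c y
proper-addEdge {x = x} {y} proper =
  (λ { u v (e , inj₁ uv) → proper u v (suc e , inj₁ uv)
     ; u v (e , inj₂ uv) → proper u v (suc e , inj₂ uv) }) ,
  proper x y (zero , inj₁ (refl , refl))

addEdge-proper : ∀ {G x y x≢y c} → Proper G c → c x ≢ c y → Proper (addEdge G x y x≢y) c
addEdge-proper proper cx≢cy u v (zero , inj₁ (refl , refl)) = cx≢cy
addEdge-proper proper cx≢cy u v (zero , inj₂ (refl , refl)) = cx≢cy ∘ sym
addEdge-proper proper cx≢cy u v (suc e , inj₁ uv) = proper u v (e , inj₁ uv)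
addEdge-proper proper cx≢cy u v (suc e , inj₂ uv) = proper u v (e , inj₂ uv)

⟨,⟩-chord : ∀ {n} (c β : Fin n → Fin 3) x y a →
  ⟨ c , (λ w → (F₃.δ x (⊖ a) w ⊕ F₃.δ y a w) ⊕ β w) ⟩ ≡ (c x ⊗ ⊖ a ⊕ c y ⊗ a) ⊕ ⟨ c , β ⟩
⟨,⟩-chord c β x y a = trans (⟨,⟩-⊕ c (λ w → F₃.δ x (⊖ a) w ⊕ F₃.δ y a w) β)
  (cong (_⊕ ⟨ c , β ⟩) (trans (⟨,⟩-⊕ c (F₃.δ x (⊖ a)) (F₃.δ y a)) (cong₂ _⊕_ (⟨,⟩-δ c x (⊖ a)) (⟨,⟩-δ c y a))))

-- The quantity is s + a(cy - cx). Its values at a = 1 and a = 2 differ because cx ≠ cy, so one of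
-- them is nonzero.
choose-chord : ∀ cx cy s → cx ≢ cy → ∃[ a ] a ≢ 0F × (cx ⊗ ⊖ a ⊕ cy ⊗ a) ⊕ s ≢ 0F
choose-chord = from-yes (all? λ cx → all? λ cy → all? λ s → ¬? (cx ≟ cy) →-dec
  any? λ a → ¬? (a ≟ 0F) ×-dec ¬? ((cx ⊗ ⊖ a ⊕ cy ⊗ a) ⊕ s ≟ 0F))

chord-undo : ∀ t t′ g → ((if t then 1F else 0F) ⊕ (if t′ then 2F else 0F)) ⊕
                        (((if t then 2F else 0F) ⊕ (if t′ then 1F else 0F)) ⊕ g) ≡ g
chord-undo false false g = refl
chord-undo false true  = from-yes (all? λ g → 2F ⊕ (1F ⊕ g) ≟ g)
chord-undo true  false = from-yes (all? λ g → 1F ⊕ (2F ⊕ g) ≟ g)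
chord-undo true  true  g = refl

chord-twice : ∀ t t′ g → ((if t then 2F else 0F) ⊕ (if t′ then 1F else 0F)) ⊕
                         (((if t then 2F else 0F) ⊕ (if t′ then 1F else 0F)) ⊕ g) ≡
                         g ⊕ ((if t then 1F else 0F) ⊕ (if t′ then 2F else 0F))
chord-twice false false = from-yes (all? λ g → g ≟ g ⊕ 0F)
chord-twice false true  = from-yes (all? λ g → 1F ⊕ (1F ⊕ g) ≟ g ⊕ 2F)
chord-twice true  false = from-yes (all? λ g → 2F ⊕ (2F ⊕ g) ≟ g ⊕ 1F)
chord-twice true  true  = from-yes (all? λ g → g ≟ g ⊕ 0F)

⊕-opposite : ∀ {a b} → a ≡ b → a ⊗ 1F ⊕ b ⊗ 2F ≡ 0F
⊕-opposite {a} refl = lemma a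
  where
  lemma : ∀ a → a ⊗ 1F ⊕ a ⊗ 2F ≡ 0F
  lemma = from-yes (all? λ a → a ⊗ 1F ⊕ a ⊗ 2F ≟ 0F)

module _ {G : Graph} (t : Tree G) {x y : Vertex G} (x≢y : x ≢ y) where

  colorable⇒Mod3-Connected : Vertex-3-Colorable (addEdge G x y x≢y) → Mod3-Connected (addEdge G x y x≢y)
  colorable⇒Mod3-Connected (c , proper) β ∑β≡0
    with properG , cx≢cy ← proper-addEdge {G} {x} {y} {x≢y} {c} proper
    with a , a≢0 , ≢0 ← choose-chord (c x) (c y) ⟨ c , β ⟩ cx≢cy =
    F₃.addEdge⁺ {G} {x} {y} {x≢y} a a≢0 (mod3-reachable t properG
      (trans (⟨,⟩-chord (λ _ → 1F) β x y a) (trans (cong ((⊖ a ⊕ a) ⊕_) ∑β≡0)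
        (cong (_⊕ 0F) (proj₁ (IsAbelianGroup.inverse ⊕-isAbelianGroup) a))))
      (≢0 ∘ trans (sym (⟨,⟩-chord c β x y a))))

  -- Put β = δ_x - δ_y, which is orthogonal to `c`, and take γ such that the tree realises neither γ
  -- nor γ + β. For the boundary γ - β of the whole graph, the extra edge leaves either γ or γ - 2β
  -- = γ + β to the tree.
  equally-coloured⇒¬Mod3-Connected : ∀ {c} → Proper G c → c x ≡ c y → ¬ Mod3-Connected (addEdge G x y x≢y)
  equally-coloured⇒¬Mod3-Connected {c} proper cx≡cy conn =
    let γ , ∑γ≡0 , ¬γ , ¬γ+β = mod3-unreachable {β = λ w → F₃.δ x 1F w ⊕ F₃.δ y 2F w} t proper
          (trans (⟨,⟩-⊕ (λ _ → 1F) (F₃.δ x 1F) (F₃.δ y 2F))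
            (cong₂ _⊕_ (⟨,⟩-δ (λ _ → 1F) x 1F) (⟨,⟩-δ (λ _ → 1F) y 2F)))
          (trans (⟨,⟩-⊕ c (F₃.δ x 1F) (F₃.δ y 2F))
            (trans (cong₂ _⊕_ (⟨,⟩-δ c x 1F) (⟨,⟩-δ c y 2F)) (⊕-opposite cx≡cy)))
    in refute γ ¬γ ¬γ+β (F₃.addEdge⁻ {G} {x} {y} {x≢y} (conn (λ w → (F₃.δ x 2F w ⊕ F₃.δ y 1F w) ⊕ γ w)
         (trans (⟨,⟩-chord (λ _ → 1F) γ x y 1F) ∑γ≡0)))
    where
    refute : ∀ γ → ¬ F₃.HasFlow G γ → ¬ F₃.HasFlow G (λ w → γ w ⊕ (F₃.δ x 1F w ⊕ F₃.δ y 2F w)) →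
      ¬ (∃[ a ] a ≢ 0F × F₃.HasFlow G (λ w →
        (F₃.δ x (⊖ a) w ⊕ F₃.δ y a w) ⊕ ((F₃.δ x 2F w ⊕ F₃.δ y 1F w) ⊕ γ w)))
    refute γ ¬γ ¬γ+β (0F , 0≢0 , _) = 0≢0 refl
    refute γ ¬γ ¬γ+β (1F , _ , φ) = ¬γ+β (F₃.flow-resp (λ w → chord-twice (does (x ≟ w)) (does (y ≟ w)) (γ w)) φ)
    refute γ ¬γ ¬γ+β (2F , _ , φ) = ¬γ (F₃.flow-resp (λ w → chord-undo (does (x ≟ w)) (does (y ≟ w)) (γ w)) φ)

  Mod3-Connected⇒colorable : Mod3-Connected (addEdge G x y x≢y) → Vertex-3-Colorable (addEdge G x y x≢y)
  Mod3-Connected⇒colorable conn with c , proper ← tree-colorable t with c x ≟ c y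
  ... | no cx≢cy  = c , addEdge-proper {G} {x} {y} {x≢y} {c} proper cx≢cy
  ... | yes cx≡cy = contradiction conn (equally-coloured⇒¬Mod3-Connected proper cx≡cy)

-- Degrees and strips

Even : ℕ → Set
Even n = 2 ∣ n

odd⇒even-suc : ∀ n → Odd n → Even (ℕ.suc n)
odd⇒even-suc 0 odd = contradiction (divides 0 refl) odd
odd⇒even-suc 1 odd = divides 1 refl
odd⇒even-suc (ℕ.suc (ℕ.suc n)) odd =
  ∣m∣n⇒∣m+n (divides 1 refl) (odd⇒even-suc n (odd ∘ ∣m∣n⇒∣m+n (divides 1 refl)))

even⇒odd-suc : ∀ {n} → Even n → Odd (ℕ.suc n)
even⇒odd-suc {n} even even′ = from-no (2 ∣? 1) (∣m+n∣m⇒∣n (subst Even (ℕ-+-comm 1 n) even′) even)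

degree-new : ∀ {y z : Vertex G} → degree (attach G y z) zero ≡ 2
degree-new {G} = cong (ℕ.suc ∘ ℕ.suc) (Sum.sum-replicate-zero ℕ-+-0 (∣E∣ G))

degree-old : ∀ {y z w : Vertex G} → w ≢ y → w ≢ z → degree (attach G y z) (suc w) ≡ degree G w
degree-old {y = y} {z} {w} w≢y w≢z
  rewrite dec-false (y ≟ w) (w≢y ∘ sym) | dec-false (z ≟ w) (w≢z ∘ sym) = refl

degree-left : ∀ {y z : Vertex G} → y ≢ z → degree (attach G y z) (suc y) ≡ ℕ.suc (degree G y)
degree-left {y = y} {z} y≢z
  rewrite dec-true (y ≟ y) refl | dec-false (z ≟ y) (y≢z ∘ sym) = refl

degree-right : ∀ {y z : Vertex G} → y ≢ z → degree (attach G y z) (suc z) ≡ ℕ.suc (degree G z)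
degree-right {y = y} {z} y≢z
  rewrite dec-true (z ≟ z) refl | dec-false (y ≟ z) y≢z = refl

degree-chord-off : ∀ {x y w : Vertex G} {x≢y} → w ≢ x → w ≢ y → degree (addEdge G x y x≢y) w ≡ degree G w
degree-chord-off {x = x} {y} {w} w≢x w≢y
  rewrite dec-false (x ≟ w) (w≢x ∘ sym) | dec-false (y ≟ w) (w≢y ∘ sym) = refl

degree-chord-source : ∀ {x y : Vertex G} {x≢y} → degree (addEdge G x y x≢y) x ≡ ℕ.suc (degree G x)
degree-chord-source {x = x} rewrite dec-true (x ≟ x) refl = refl

degree-chord-target : ∀ {x y : Vertex G} {x≢y} → degree (addEdge G x y x≢y) y ≡ ℕ.suc (degree G y)
degree-chord-target {x = x} {y} {x≢y} rewrite dec-false (x ≟ y) x≢y | dec-true (y ≟ y) refl = refl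

-- Strip G v r s p q: a sequence of triangles, each sharing an edge of the previous one that
-- contains its last vertex.  It starts at the triangle vrs, and the next triangle will be
-- attached to pq; attaching it gives a triangle-path with the new vertex and v as leaves.
data Strip : (G : Graph) (v r s p q : Vertex G) → Set where
  base    : Strip triangle 0F 1F 2F 1F 2F
  grow    : ∀ {v r s p q} → Strip G v r s p q → Strip (attach G p q) (suc v) (suc r) (suc s) zero (suc p)
  flipEnd : ∀ {v r s p q} → Strip G v r s p q → Strip G v r s q p
  flipTip : ∀ {v r s p q} → Strip G v r s p q → Strip G v s r p q
  relabel : ∀ {v r s p q} → Strip G v r s p q → (i : G ≅ H) → Strip H (i · v) (i · r) (i · s) (i · p) (i · q)

-- The growing edge avoids `v`, so growth leaves the start of the strip untouched: `v` remains a
-- leaf, and a triangle attached there must sit on vr or vs.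
record Tip (G : Graph) (v r s p q : Vertex G) : Set where
  field
    p≢q        : p ≢ q
    v≢p        : v ≢ p
    v≢q        : v ≢ q
    leaf       : Leaf G v
    neighbours : ∀ {z} → Adjacent G v z → z ≡ r ⊎ z ≡ s

tip : ∀ {v r s p q} → Strip G v r s p q → Tip G v r s p q
tip base = record
  { p≢q        = λ ()
  ; v≢p        = λ ()
  ; v≢q        = λ ()
  ; leaf       = refl
  ; neighbours = λ { {0F} vv → contradiction refl (adjacent⇒≢ triangle vv)
                   ; {1F} _  → inj₁ refl
                   ; {2F} _  → inj₂ refl }
  }
tip (grow {G} {v} {r} {s} {p} {q} strip) = record
  { p≢q        = λ ()
  ; v≢p        = λ ()
  ; v≢q        = v≢p ∘ suc-injective
  ; leaf       = trans (degree-old {G} v≢p v≢q) leaf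
  ; neighbours = next
  }
  where
  open Tip (tip strip)
  next : ∀ {z} → Adjacent (attach G p q) (suc v) z → z ≡ suc r ⊎ z ≡ suc s
  next {zero}  vz with attach-new {y = p} {q} (adjacent-sym (attach G p q) vz)
  ... | inj₁ v≡p = contradiction v≡p v≢p
  ... | inj₂ v≡q = contradiction v≡q v≢q
  next {suc z} vz with neighbours (attach-old {y = p} {q} vz)
  ... | inj₁ z≡r = inj₁ (cong suc z≡r)
  ... | inj₂ z≡s = inj₂ (cong suc z≡s)
tip (flipEnd strip) = record
  { p≢q = p≢q ∘ sym ; v≢p = v≢q ; v≢q = v≢p ; leaf = leaf ; neighbours = neighbours }
  where open Tip (tip strip)
tip (flipTip strip) = record
  { p≢q = p≢q ; v≢p = v≢p ; v≢q = v≢q ; leaf = leaf ; neighbours = swap ∘ neighbours }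
  where open Tip (tip strip)
tip (relabel {G} {H} {v} {r} {s} strip i) = record
  { p≢q        = p≢q ∘ ·-injective i
  ; v≢p        = v≢p ∘ ·-injective i
  ; v≢q        = v≢q ∘ ·-injective i
  ; leaf       = trans (degree-map i v) leaf
  ; neighbours = next
  }
  where
  open Tip (tip strip)
  next : ∀ {z} → Adjacent H (i · v) z → z ≡ i · r ⊎ z ≡ i · s
  next {z} vz with neighbours (subst (λ u → Adjacent G u (≅-sym i · z)) (Perm.inverseˡ (_≅_.vertices i)) (adjacent-map (≅-sym i) vz))
  ... | inj₁ z≡r = inj₁ (trans (sym (·-sym-· i z)) (cong (i ·_) z≡r))
  ... | inj₂ z≡s = inj₂ (trans (sym (·-sym-· i z)) (cong (i ·_) z≡s))

-- Explicit isomorphisms, and strips lengthened at their start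

module _ {G H : Graph} (φ : Vec (Vertex H) (∣V∣ G)) (φ⁻ : Vec (Vertex G) (∣V∣ H))
  (ψ : Vec (Edge H) (∣E∣ G)) (ψ⁻ : Vec (Edge G) (∣E∣ H)) where

  IsIso : Set
  IsIso = (∀ v → lookup φ (lookup φ⁻ v) ≡ v) × (∀ v → lookup φ⁻ (lookup φ v) ≡ v) ×
          (∀ e → lookup ψ (lookup ψ⁻ e) ≡ e) × (∀ e → lookup ψ⁻ (lookup ψ e) ≡ e) ×
          (∀ e → Joins H (lookup ψ e) (lookup φ (end₁ G e)) (lookup φ (end₂ G e)))

  isIso? : Dec IsIso
  isIso? = (all? λ v → lookup φ (lookup φ⁻ v) ≟ v) ×-dec (all? λ v → lookup φ⁻ (lookup φ v) ≟ v) ×-dec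
           (all? λ e → lookup ψ (lookup ψ⁻ e) ≟ e) ×-dec (all? λ e → lookup ψ⁻ (lookup ψ e) ≟ e) ×-dec
           (all? λ e → ((end₁ H (lookup ψ e) ≟ lookup φ (end₁ G e)) ×-dec (end₂ H (lookup ψ e) ≟ lookup φ (end₂ G e)))
                 ⊎-dec ((end₁ H (lookup ψ e) ≟ lookup φ (end₂ G e)) ×-dec (end₂ H (lookup ψ e) ≟ lookup φ (end₁ G e))))

  table : {True isIso?} → G ≅ H
  table {ok} = let φφ⁻ , φ⁻φ , ψψ⁻ , ψ⁻ψ , ends = toWitness ok in record
    { vertices = Perm.permutation (lookup φ) (lookup φ⁻) φφ⁻ φ⁻φ
    ; edges    = Perm.permutation (lookup ψ) (lookup ψ⁻) ψψ⁻ ψ⁻ψ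
    ; ends     = ends
    }

rotation : triangle ≅ triangle
rotation = table (1F ∷ 2F ∷ 0F ∷ []) (2F ∷ 0F ∷ 1F ∷ []) (1F ∷ 2F ∷ 0F ∷ []) (2F ∷ 0F ∷ 1F ∷ [])

-- Rotations carry the growing edge of `base` to every edge of the triangle, and `flipEnd` orders
-- its ends.
triangle-strip : ∀ p q → p ≢ q → ∃[ v ] ∃[ r ] ∃[ s ] Strip triangle v r s p q
triangle-strip 0F 0F p≢q = contradiction refl p≢q
triangle-strip 0F 1F _   = _ , _ , _ , relabel (relabel base rotation) rotation
triangle-strip 0F 2F _   = _ , _ , _ , flipEnd (relabel base rotation)
triangle-strip 1F 0F _   = _ , _ , _ , flipEnd (relabel (relabel base rotation) rotation)
triangle-strip 1F 1F p≢q = contradiction refl p≢q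
triangle-strip 1F 2F _   = _ , _ , _ , base
triangle-strip 2F 0F _   = _ , _ , _ , relabel base rotation
triangle-strip 2F 1F _   = _ , _ , _ , flipEnd base
triangle-strip 2F 2F p≢q = contradiction refl p≢q

-- A triangle attached at the start makes the new vertex the starting leaf and keeps the growing
-- edge. The attachment is moved past each `grow` by `attach-comm`; vr and vs are treated together
-- because `flipTip` exchanges them.
prepend : ∀ {v r s p q} → Strip G v r s p q →
          Strip (attach G v r) zero (suc v) (suc r) (suc p) (suc q) ×
          Strip (attach G v s) zero (suc v) (suc s) (suc p) (suc q)
prepend base =
  -- Both four-vertex graphs are `grow base` renumbered so that its starting vertex becomes the new
  -- vertex and its grown vertex an end of pq.
  flipEnd (flipTip (relabel (grow base)
    (table (3F ∷ 0F ∷ 2F ∷ 1F ∷ []) (1F ∷ 3F ∷ 2F ∷ 0F ∷ []) (3F ∷ 4F ∷ 1F ∷ 2F ∷ 0F ∷ []) (4F ∷ 2F ∷ 3F ∷ 0F ∷ 1F ∷ [])))) ,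
  flipTip (relabel (grow base)
    (table (2F ∷ 0F ∷ 3F ∷ 1F ∷ []) (1F ∷ 3F ∷ 0F ∷ 2F ∷ []) (3F ∷ 2F ∷ 1F ∷ 4F ∷ 0F ∷ []) (4F ∷ 2F ∷ 1F ∷ 0F ∷ 3F ∷ [])))
prepend (grow strip) =
  relabel (grow (proj₁ (prepend strip))) attach-comm , relabel (grow (proj₂ (prepend strip))) attach-comm
prepend (flipEnd strip) = flipEnd (proj₁ (prepend strip)) , flipEnd (proj₂ (prepend strip))
prepend (flipTip strip) = proj₂ (prepend strip) , proj₁ (prepend strip)
prepend (relabel strip i) =
  relabel (proj₁ (prepend strip)) (attach-cong i) , relabel (proj₂ (prepend strip)) (attach-cong i)

-- Leaves of triangle-trees

-- Nonadjacency ensures that the edge of a further attachment contains at most one of the two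
-- leaves.
record FarLeaves (G : Graph) (a b : Vertex G) : Set where
  constructor farLeaves
  field
    leaf₁    : Leaf G a
    leaf₂    : Leaf G b
    distinct : a ≢ b
    apart    : ¬ Adjacent G a b

far-map : (i : G ≅ H) {a b : Vertex G} → FarLeaves G a b → FarLeaves H (i · a) (i · b)
far-map {G} i {a} {b} (farLeaves la lb a≢b apart) = farLeaves
  (trans (degree-map i a) la) (trans (degree-map i b) lb) (a≢b ∘ ·-injective i)
  λ ab → apart (subst₂ (Adjacent G) (Perm.inverseˡ (_≅_.vertices i)) (Perm.inverseˡ (_≅_.vertices i))
    (adjacent-map (≅-sym i) ab))

infix 4 _∈[_,_]

_∈[_,_] : ∀ {n} → Fin n → Fin n → Fin n → Set
a ∈[ y , z ] = a ≡ y ⊎ a ≡ z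

far-new : ∀ {y z a : Vertex G} → Leaf G a → ¬ a ∈[ y , z ] → FarLeaves (attach G y z) zero (suc a)
far-new {G} {y} {z} la a∉ = farLeaves (degree-new {G} {y} {z}) (trans (degree-old {G} (a∉ ∘ inj₁) (a∉ ∘ inj₂)) la) (λ ())
  (a∉ ∘ attach-new {y = y} {z})

far-old : ∀ {y z a b : Vertex G} → FarLeaves G a b → ¬ a ∈[ y , z ] → ¬ b ∈[ y , z ] →
          FarLeaves (attach G y z) (suc a) (suc b)
far-old {G} {y} {z} (farLeaves la lb a≢b apart) a∉ b∉ = farLeaves
  (trans (degree-old {G} (a∉ ∘ inj₁) (a∉ ∘ inj₂)) la) (trans (degree-old {G} (b∉ ∘ inj₁) (b∉ ∘ inj₂)) lb)
  (a≢b ∘ suc-injective) (apart ∘ attach-old {y = y} {z})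

-- The strip of a `path` stops one triangle early, so that both leaves of the path are visible.
-- Three pairwise nonadjacent leaves, once present, are never lost, which excludes exactly two
-- leaves.
data Shape (G : Graph) : Set where
  triangular : triangle ≅ G → Shape G
  path       : ∀ {H v r s p q} → Strip H v r s p q → attach H p q ≅ G → Shape G
  branched   : ∀ {a b c} → FarLeaves G a b → FarLeaves G a c → FarLeaves G b c → Shape G

shape-map : G ≅ H → Shape G → Shape H
shape-map i (triangular j)          = triangular (≅-trans j i)
shape-map i (path strip j)          = path strip (≅-trans j i)
shape-map i (branched ab ac bc)     = branched (far-map i ab) (far-map i ac) (far-map i bc)

branch : ∀ {y z a b : Vertex G} → FarLeaves G a b → ¬ a ∈[ y , z ] → ¬ b ∈[ y , z ] → Shape (attach G y z)
branch ab@(farLeaves la lb _ _) a∉ b∉ = branched (far-new la a∉) (far-new lb b∉) (far-old ab a∉ b∉)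

far-edge : ∀ {y z a b : Vertex G} → FarLeaves G a b → Adjacent G y z → a ∈[ y , z ] → ¬ b ∈[ y , z ]
far-edge     (farLeaves _ _ a≢b _)   yz (inj₁ refl) (inj₁ refl) = a≢b refl
far-edge     (farLeaves _ _ _ apart) yz (inj₁ refl) (inj₂ refl) = apart yz
far-edge {G} (farLeaves _ _ _ apart) yz (inj₂ refl) (inj₁ refl) = apart (adjacent-sym G yz)
far-edge     (farLeaves _ _ a≢b _)   yz (inj₂ refl) (inj₂ refl) = a≢b refl

tip-far : ∀ {v r s p q} → Strip G v r s p q → FarLeaves (attach G p q) zero (suc v)
tip-far strip = far-new leaf [ v≢p , v≢q ]
  where open Tip (tip strip)

-- An attachment at the newest vertex continues the strip, one at `v` lengthens it at its start, and
-- any other leaves both ends as leaves and creates a third.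
strip-attach : ∀ {v r s p q} → Strip G v r s p q → ∀ {a b} → Adjacent (attach G p q) a b →
               Shape (attach (attach G p q) a b)
strip-attach {G} {v} {r} {s} {p} {q} strip {a} {b} = cases a b
  where
  open Tip (tip strip)
  T = attach G p q

  from-new : ∀ b → Adjacent T zero (suc b) → Shape (attach T zero (suc b))
  from-new b 0b with attach-new {y = p} {q} 0b
  ... | inj₁ refl = path (grow strip) ≅-refl
  ... | inj₂ refl = path (relabel (grow (flipEnd strip)) attach-swap) ≅-refl

  from-tip : ∀ b → Adjacent G v b → Shape (attach T (suc v) (suc b))
  from-tip b vb with neighbours vb
  ... | inj₁ refl = path (proj₁ (prepend strip)) attach-comm
  ... | inj₂ refl = path (proj₂ (prepend strip)) attach-comm

  cases : ∀ a b → Adjacent T a b → Shape (attach T a b)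
  cases zero    zero    ab = contradiction refl (adjacent⇒≢ T ab)
  cases zero    (suc b) ab = from-new b ab
  cases (suc a) zero    ab = shape-map attach-swap (from-new a (adjacent-sym T ab))
  cases (suc a) (suc b) ab with a ≟ v | b ≟ v
  ... | yes refl | _        = from-tip b (attach-old {y = p} {q} ab)
  ... | no _     | yes refl = shape-map attach-swap (from-tip a (attach-old {y = p} {q} (adjacent-sym T ab)))
  ... | no a≢v   | no b≢v   = branch (tip-far strip) [ (λ ()) , (λ ()) ]
    [ a≢v ∘ sym ∘ suc-injective , b≢v ∘ sym ∘ suc-injective ]

shape-attach : ∀ {y z : Vertex G} → Shape G → Adjacent G y z → Shape (attach G y z)
shape-attach {G} (triangular i) yz
  with _ , _ , _ , strip ← triangle-strip _ _ (adjacent⇒≢ triangle (adjacent-map (≅-sym i) yz)) =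
  path strip (≅-sym (attach-cong (≅-sym i)))
shape-attach (path strip i) yz =
  shape-map (≅-sym (attach-cong (≅-sym i))) (strip-attach strip (adjacent-map (≅-sym i) yz))
shape-attach {y = y} {z} (branched {a} {b} {c} ab ac bc) yz with (a ≟ y) ⊎-dec (a ≟ z) | (b ≟ y) ⊎-dec (b ≟ z)
-- The attachment edge meets at most one of the three leaves; the new vertex takes its place.
... | yes a∈ | _      = branch bc (far-edge ab yz a∈) (far-edge ac yz a∈)
... | no a∉  | yes b∈ = branch ac a∉ (far-edge bc yz b∈)
... | no a∉  | no b∉  = branch ab a∉ b∉

tree-shape : Tree G → Shape G
tree-shape base           = triangular ≅-refl
tree-shape (extend t yz)  = shape-attach (tree-shape t) yz

-- Flows along a strip

-- Modulo 3, a boundary with zero sum that is -1 at `v` and vanishes off v, p, q has the values (1,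
-- 0), (0, 1) or (2, 2) at p, q. These are integer representatives of the three classes.
Flow-p Flow-q Flow-pq : (G : Graph) (v p q : Vertex G) → Set
Flow-p  G v p q = Fℤ.HasFlow G (Fℤ.at p q v (+ 1) (+ 0) (- + 1))
Flow-q  G v p q = Fℤ.HasFlow G (Fℤ.at p q v (+ 0) (+ 1) (- + 1))
Flow-pq G v p q = Fℤ.HasFlow G (Fℤ.at p q v (+ 2) (- + 1) (- + 1)) ⊎
                  Fℤ.HasFlow G (Fℤ.at p q v (- + 1) (+ 2) (- + 1))

-- A flow of attach G p q carrying one unit from the new vertex to v sends 2 and -1, in some order,
-- from the new vertex to p and q, so it restricts to a Flow-pq on G.  Modulo 3 both variants of
-- Flow-pq have boundary 2 at p, q and v; hence blocked below excludes Flow-pq in EvenEven, and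
-- Flow-q in OddEven, already modulo 3.
record EvenEven (G : Graph) (v p q : Vertex G) : Set where
  field
    others  : ∀ w → w ≢ v → w ≢ p → w ≢ q → Odd (degree G w)
    even-p  : Even (degree G p)
    even-q  : Even (degree G q)
    flow-p  : Flow-p G v p q
    flow-q  : Flow-q G v p q
    blocked : ∀ {a} → a ≢ 0F → ¬ F₃.HasFlow G (F₃.at p q v a a a)

record OddEven (G : Graph) (v p q : Vertex G) : Set where
  field
    others  : ∀ w → w ≢ v → w ≢ p → w ≢ q → Odd (degree G w)
    odd-p   : Odd (degree G p)
    even-q  : Even (degree G q)
    flow-p  : Flow-p G v p q
    flow-pq : Flow-pq G v p q
    blocked : ∀ {a} → a ≢ 0F → ¬ F₃.HasFlow G (F₃.at p q v 0F a (⊖ a))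

-- The vertex `w` lies off the growing edge, so its even degree is final.
record Unblocked (G : Graph) (v p q : Vertex G) : Set where
  field
    {w}     : Vertex G
    w≢v     : w ≢ v
    w≢p     : w ≢ p
    w≢q     : w ≢ q
    even-w  : Even (degree G w)
    flow-p  : Flow-p G v p q
    flow-q  : Flow-q G v p q
    flow-pq : Flow-pq G v p q

data State (G : Graph) (v p q : Vertex G) : Set where
  evenEven  : EvenEven G v p q → State G v p q
  oddEven   : OddEven G v p q → State G v p q
  evenOdd   : OddEven G v q p → State G v p q
  unblocked : Unblocked G v p q → State G v p q

module _ {v p q : Vertex G} where

  flip-pq : Flow-pq G v p q → Flow-pq G v q p
  flip-pq (inj₁ φ) = inj₂ (Fℤ.flow-flip φ)
  flip-pq (inj₂ φ) = inj₁ (Fℤ.flow-flip φ)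

  -- With values k, l on the edges to p, q, boundary (0, 1) at the new vertex and `p` means k + l =
  -- 0 and leaves (1 + k, l) at p, q. The choices k = -1, 1, -2 give (0, 1), (2, -1), (-1, 2). The
  -- next two lemmas solve the analogous equations.
  grow-p : Flow-q G v p q ⊎ Flow-pq G v p q → Flow-q (attach G p q) (suc v) zero (suc p)
  grow-p (inj₁ φ)        = Fℤ.grow⁺ (- + 1) (+ 1) is-1 is1 refl φ
  grow-p (inj₂ (inj₁ φ)) = Fℤ.grow⁺ (+ 1) (- + 1) is1 is-1 refl φ
  grow-p (inj₂ (inj₂ φ)) = Fℤ.grow⁺ (- + 2) (+ 2) is-2 is2 refl φ

  grow-new : Flow-pq G v p q → Flow-p (attach G p q) (suc v) zero (suc p)
  grow-new (inj₁ φ) = Fℤ.grow⁺ (+ 2) (- + 1) is2 is-1 refl φ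
  grow-new (inj₂ φ) = Fℤ.grow⁺ (- + 1) (+ 2) is-1 is2 refl φ

  grow-pq : Flow-q G v p q → Flow-pq (attach G p q) (suc v) zero (suc p)
  grow-pq φ = inj₂ (Fℤ.grow⁺ (- + 2) (+ 1) is-2 is1 refl φ)

  blocked-grow : ∀ {α γ c} → α ≢ 0F → ¬ F₃.HasFlow G (F₃.at p q v (γ ⊕ ⊖ α) (⊖ α) c) →
                 ¬ F₃.HasFlow (attach G p q) (F₃.at zero (suc p) (suc v) α γ c)
  blocked-grow {α} α≢0 ¬φ φ
    with k , l , k≢0 , l≢0 , k+l≡ , φ′ ← F₃.grow⁻ φ
    with refl , refl ← nonzero-sum α k l k≢0 l≢0 k+l≡ α≢0 = ¬φ φ′

flip-state : ∀ {v p q} → State G v p q → State G v q p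
flip-state (evenEven s) = evenEven record
  { others  = λ w w≢v w≢p w≢q → others w w≢v w≢q w≢p
  ; even-p  = even-q
  ; even-q  = even-p
  ; flow-p  = Fℤ.flow-flip flow-q
  ; flow-q  = Fℤ.flow-flip flow-p
  ; blocked = λ a≢0 → blocked a≢0 ∘ F₃.flow-flip
  }
  where open EvenEven s
flip-state (oddEven s) = evenOdd s
flip-state (evenOdd s) = oddEven s
flip-state (unblocked s) = unblocked record
  { w≢v     = w≢v
  ; w≢p     = w≢q
  ; w≢q     = w≢p
  ; even-w  = even-w
  ; flow-p  = Fℤ.flow-flip flow-q
  ; flow-q  = Fℤ.flow-flip flow-p
  ; flow-pq = flip-pq flow-pq
  }
  where open Unblocked s

module _ (i : G ≅ H) {v p q : Vertex G} where

  others-map : (∀ w → w ≢ v → w ≢ p → w ≢ q → Odd (degree G w)) →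
               ∀ w → w ≢ i · v → w ≢ i · p → w ≢ i · q → Odd (degree H w)
  others-map others w w≢v w≢p w≢q = subst Odd (degree-map (≅-sym i) w)
    (others (≅-sym i · w) (w≢v ∘ back) (w≢p ∘ back) (w≢q ∘ back))
    where
    back : ∀ {u} → ≅-sym i · w ≡ u → w ≡ i · u
    back refl = sym (·-sym-· i w)

  flow-pq-map : Flow-pq G v p q → Flow-pq H (i · v) (i · p) (i · q)
  flow-pq-map (inj₁ φ) = inj₁ (Fℤ.at-transport i φ)
  flow-pq-map (inj₂ φ) = inj₂ (Fℤ.at-transport i φ)

  blocked-map : ∀ {a b c} → ¬ F₃.HasFlow G (F₃.at p q v a b c) →
                ¬ F₃.HasFlow H (F₃.at (i · p) (i · q) (i · v) a b c)
  blocked-map {a} {b} {c} ¬φ φ = ¬φ (subst₂ (λ p q → F₃.HasFlow G (F₃.at p q v a b c)) back back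
    (subst (λ v → F₃.HasFlow G (F₃.at (≅-sym i · (i · p)) (≅-sym i · (i · q)) v a b c)) back
      (F₃.at-transport (≅-sym i) φ)))
    where
    back : ∀ {u} → ≅-sym i · (i · u) ≡ u
    back = Perm.inverseˡ (_≅_.vertices i)

oddEven-map : (i : G ≅ H) {v p q : Vertex G} → OddEven G v p q → OddEven H (i · v) (i · p) (i · q)
oddEven-map i {v} {p} {q} s = record
  { others  = others-map i others
  ; odd-p   = subst Odd (sym (degree-map i p)) odd-p
  ; even-q  = subst Even (sym (degree-map i q)) even-q
  ; flow-p  = Fℤ.at-transport i flow-p
  ; flow-pq = flow-pq-map i flow-pq
  ; blocked = λ a≢0 → blocked-map i (blocked a≢0)
  }
  where open OddEven s

state-map : (i : G ≅ H) {v p q : Vertex G} → State G v p q → State H (i · v) (i · p) (i · q)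
state-map i {v} {p} {q} (evenEven s) = evenEven record
  { others  = others-map i others
  ; even-p  = subst Even (sym (degree-map i p)) even-p
  ; even-q  = subst Even (sym (degree-map i q)) even-q
  ; flow-p  = Fℤ.at-transport i flow-p
  ; flow-q  = Fℤ.at-transport i flow-q
  ; blocked = λ a≢0 → blocked-map i (blocked a≢0)
  }
  where open EvenEven s
state-map i (oddEven s) = oddEven (oddEven-map i s)
state-map i (evenOdd s) = evenOdd (oddEven-map i s)
state-map i {v} {p} {q} (unblocked s) = unblocked record
  { w≢v     = w≢v ∘ ·-injective i
  ; w≢p     = w≢p ∘ ·-injective i
  ; w≢q     = w≢q ∘ ·-injective i
  ; even-w  = subst Even (sym (degree-map i w)) even-w
  ; flow-p  = Fℤ.at-transport i flow-p
  ; flow-q  = Fℤ.at-transport i flow-q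
  ; flow-pq = flow-pq-map i flow-pq
  }
  where open Unblocked s

triangle-state : EvenEven triangle 0F 1F 2F
triangle-state = record
  { others  = λ { 0F w≢v _ _ → contradiction refl w≢v
                ; 1F _ w≢p _ → contradiction refl w≢p
                ; 2F _ _ w≢q → contradiction refl w≢q }
  ; even-p  = divides 1 refl
  ; even-q  = divides 1 refl
  ; flow-p  = Fℤ.flow f (λ { 0F → is-2 ; 1F → is-1 ; 2F → is1 })
                λ w → trans (∂-p w) (sym (Fℤ.at-def 1F 2F 0F (+ 1) (+ 0) (- + 1) w))
  ; flow-q  = Fℤ.flow g (λ { 0F → is1 ; 1F → is1 ; 2F → is-2 })
                λ w → trans (∂-q w) (sym (Fℤ.at-def 1F 2F 0F (+ 0) (+ 1) (- + 1) w))
  -- Here p, q and v are all the vertices, so this boundary is constant.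
  ; blocked = λ {a} a≢0 → triangle-unreachable a≢0 ∘ F₃.flow-resp
                λ w → trans (F₃.at-def 1F 2F 0F a a a w) (constant a w)
  }
  where
  open IsAbelianGroup ⊕-isAbelianGroup using (identityʳ)

  f g : Fin 3 → ℤ
  f = λ { 0F → - + 2 ; 1F → - + 1 ; 2F → + 1 }
  g = λ { 0F → + 1 ; 1F → + 1 ; 2F → - + 2 }

  ∂-p : ∀ w → Fℤ.∂ triangle f w ≡
        (Fℤ.δ 1F (+ 1) w Data.Integer.Base.+ Fℤ.δ 2F (+ 0) w) Data.Integer.Base.+ Fℤ.δ 0F (- + 1) w
  ∂-p = λ { 0F → refl ; 1F → refl ; 2F → refl }

  ∂-q : ∀ w → Fℤ.∂ triangle g w ≡
        (Fℤ.δ 1F (+ 0) w Data.Integer.Base.+ Fℤ.δ 2F (+ 1) w) Data.Integer.Base.+ Fℤ.δ 0F (- + 1) w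
  ∂-q = λ { 0F → refl ; 1F → refl ; 2F → refl }

  constant : ∀ a (w : Fin 3) → (F₃.δ 1F a w ⊕ F₃.δ 2F a w) ⊕ F₃.δ 0F a w ≡ a
  constant a = λ { 0F → refl ; 1F → trans (identityʳ _) (identityʳ a) ; 2F → identityʳ a }

module _ {v r s p q} (strip : Strip G v r s p q) where
  open Tip (tip strip)

  others-grow : (∀ w → w ≢ v → w ≢ p → w ≢ q → Odd (degree G w)) → Even (degree G q) →
                ∀ w → w ≢ suc v → w ≢ suc p → w ≢ zero → Odd (degree (attach G p q) w)
  others-grow others even-q zero    _   _   w≢0 = contradiction refl w≢0
  others-grow others even-q (suc w) w≢v w≢p _ with w ≟ q
  ... | yes refl = subst Odd (sym (degree-right {G} p≢q)) (even⇒odd-suc even-q)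
  ... | no w≢q   = subst Odd (sym (degree-old {G} (w≢p ∘ cong suc) w≢q)) (others w (w≢v ∘ cong suc) (w≢p ∘ cong suc) w≢q)

  -- Growing finishes `q` and raises its degree by one. An even `q` becomes odd and, if one type of
  -- flow was missing, one still is; an odd `q` becomes even, and from then on all types exist.
  grow-state : State G v p q → State (attach G p q) (suc v) zero (suc p)
  grow-state (evenEven st) = evenOdd record
    { others  = others-grow others even-q
    ; odd-p   = subst Odd (sym (degree-left {G} p≢q)) (even⇒odd-suc even-p)
    ; even-q  = subst Even (sym (degree-new {G} {p} {q})) (divides 1 refl)
    ; flow-p  = Fℤ.flow-flip (grow-p (inj₁ flow-q))
    ; flow-pq = flip-pq (grow-pq flow-q)
    ; blocked = λ a≢0 → blocked-grow a≢0 (blocked (⊖-nonzero a≢0)) ∘ F₃.flow-flip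
    }
    where open EvenEven st
  grow-state (oddEven st) = evenEven record
    { others  = λ w w≢v w≢0 w≢p → others-grow others even-q w w≢v w≢p w≢0
    ; even-p  = subst Even (sym (degree-new {G} {p} {q})) (divides 1 refl)
    ; even-q  = subst Even (sym (degree-left {G} p≢q)) (odd⇒even-suc _ odd-p)
    ; flow-p  = grow-new flow-pq
    ; flow-q  = grow-p (inj₂ flow-pq)
    -- Splitting on the value lets a - a and -(-a) compute.
    ; blocked = λ { {0F} a≢0 → contradiction refl a≢0
                  ; {1F} a≢0 → blocked-grow a≢0 (blocked {2F} λ ())
                  ; {2F} a≢0 → blocked-grow a≢0 (blocked {1F} λ ()) }
    }
    where open OddEven st
  grow-state (evenOdd st) = unblocked record
    { w       = suc q
    ; w≢v     = v≢q ∘ sym ∘ suc-injective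
    ; w≢p     = λ ()
    ; w≢q     = p≢q ∘ sym ∘ suc-injective
    ; even-w  = subst Even (sym (degree-right {G} p≢q)) (odd⇒even-suc _ odd-p)
    ; flow-p  = grow-new (flip-pq flow-pq)
    ; flow-q  = grow-p (inj₂ (flip-pq flow-pq))
    ; flow-pq = grow-pq (Fℤ.flow-flip flow-p)
    }
    where open OddEven st
  grow-state (unblocked st) = unblocked record
    { w≢v     = w≢v ∘ suc-injective
    ; w≢p     = λ ()
    ; w≢q     = w≢p ∘ suc-injective
    ; even-w  = subst Even (sym (degree-old {G} w≢p w≢q)) even-w
    ; flow-p  = grow-new flow-pq
    ; flow-q  = grow-p (inj₂ flow-pq)
    ; flow-pq = grow-pq flow-q
    }
    where open Unblocked st

strip-state : ∀ {v r s p q} → Strip G v r s p q → State G v p q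
strip-state base              = evenEven triangle-state
strip-state (grow strip)      = grow-state strip (strip-state strip)
strip-state (flipEnd strip)   = flip-state (strip-state strip)
strip-state (flipTip strip)   = strip-state strip
strip-state (relabel strip i) = state-map i (strip-state strip)

-- Each alternative decides both sides of (i): flows are excluded modulo 3 but exhibited over ℤ.
data Verdict (G : Graph) : Set where
  odd-no-flow : (∀ v → Odd (degree G v)) → ¬ F₃.HasFlow G (λ _ → 0F) → Verdict G
  even-flow   : ∀ {v} → Even (degree G v) → Fℤ.HasFlow G (λ _ → 0ℤ) → Verdict G

verdict-map : G ≅ H → Verdict G → Verdict H
verdict-map i (odd-no-flow odd ¬φ) = odd-no-flow
  (λ v → subst Odd (degree-map (≅-sym i) v) (odd (≅-sym i · v))) (¬φ ∘ F₃.transport (≅-sym i))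
verdict-map i (even-flow {v} even φ) = even-flow (subst Even (sym (degree-map i v)) even) (Fℤ.transport i φ)

verdict⇒⇔ : Verdict G → (¬ HasNowhereZero3Flow G) ⇔ (∀ v → Odd (degree G v))
verdict⇒⇔ (odd-no-flow odd ¬φ) = mk⇔ (λ _ → odd) (λ _ → ¬φ ∘ HasNowhereZero3Flow⇒mod3)
verdict⇒⇔ (even-flow even φ)   = mk⇔
  (λ ¬φ → contradiction (integral⇒HasNowhereZero3Flow φ) ¬φ) (λ odd → contradiction even (odd _))

module _ {v r s p q} (strip : Strip G v r s p q) {0≢v : zero ≢ suc v} where
  open Tip (tip strip)

  private
    T = attach G p q
    C = addEdge T zero (suc v) 0≢v

  closed-degree : ∀ w → w ≢ v → degree C (suc w) ≡ degree T (suc w)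
  closed-degree w w≢v = degree-chord-off {T} {x≢y = 0≢v} (λ ()) (w≢v ∘ suc-injective)

  -- The chord returns the unit that `grow-new` sends from the new vertex to `v`.
  strip-flow : Flow-pq G v p q → Fℤ.HasFlow C (λ _ → 0ℤ)
  strip-flow φ = Fℤ.close⁺ {G} {p} {q} {v} {0≢v} (- + 1) is-1 (grow-new φ)

  -- Closing gives both leaves degree 3 and raises `p` and `q` by one. All degrees become odd
  -- exactly in the state `evenEven`; every other state supplies an even vertex and a `Flow-pq`.
  state-verdict : State G v p q → Verdict C
  state-verdict (evenEven st) = odd-no-flow odd (no-flow ∘ F₃.close⁻ {G} {p} {q} {v} {0≢v})
    where
    open EvenEven st
    odd : ∀ w → Odd (degree C w)
    odd zero = subst Odd (sym (trans (degree-chord-source {T} {x≢y = 0≢v}) (cong ℕ.suc (degree-new {G} {p} {q}))))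
      (even⇒odd-suc (divides 1 refl))
    odd (suc w) with w ≟ v | w ≟ p | w ≟ q
    ... | yes refl | _ | _ = subst Odd
      (sym (trans (degree-chord-target {T} {x≢y = 0≢v}) (cong ℕ.suc (trans (degree-old {G} v≢p v≢q) leaf))))
      (even⇒odd-suc (divides 1 refl))
    ... | no w≢v | yes refl | _ =
      subst Odd (sym (trans (closed-degree w w≢v) (degree-left {G} p≢q))) (even⇒odd-suc even-p)
    ... | no w≢v | no _ | yes refl =
      subst Odd (sym (trans (closed-degree w w≢v) (degree-right {G} p≢q))) (even⇒odd-suc even-q)
    ... | no w≢v | no w≢p | no w≢q =
      subst Odd (sym (trans (closed-degree w w≢v) (degree-old {G} w≢p w≢q))) (others w w≢v w≢p w≢q)

    no-flow : ¬ (∃[ a ] a ≢ 0F × F₃.HasFlow T (F₃.at zero (suc p) (suc v) (⊖ a) 0F a))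
    no-flow (0F , a≢0 , _) = a≢0 refl
    -- Boundary -a at the new vertex forces the value a on its two edges in the path, which leaves
    -- the blocked boundary a, a, a at p, q, v.
    no-flow (1F , _ , φ)   = blocked-grow (λ ()) (blocked {1F} λ ()) φ
    no-flow (2F , _ , φ)   = blocked-grow (λ ()) (blocked {2F} λ ()) φ
  state-verdict (oddEven st) = even-flow {v = suc p}
    (subst Even (sym (trans (closed-degree p (v≢p ∘ sym)) (degree-left {G} p≢q))) (odd⇒even-suc _ odd-p))
    (strip-flow flow-pq)
    where open OddEven st
  state-verdict (evenOdd st) = even-flow {v = suc q}
    (subst Even (sym (trans (closed-degree q (v≢q ∘ sym)) (degree-right {G} p≢q))) (odd⇒even-suc _ odd-p))
    (strip-flow (flip-pq flow-pq))
    where open OddEven st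
  state-verdict (unblocked st) = even-flow {v = suc w}
    (subst Even (sym (trans (closed-degree w w≢v) (degree-old {G} w≢p w≢q))) even-w)
    (strip-flow flow-pq)
    where open Unblocked st

-- Crystals

doubled-triangle : ∀ {x y} (x≢y : x ≢ y) w a b c → Small a → Small b → Small c →
  Even (degree (addEdge triangle x y x≢y) w) →
  (∀ v → Fℤ.∂ (addEdge triangle x y x≢y) (λ { 0F → + 1 ; 1F → a ; 2F → b ; 3F → c }) v ≡ 0ℤ) →
  Verdict (addEdge triangle x y x≢y)
doubled-triangle x≢y w a b c sa sb sc even ∂≡0 = even-flow {v = w} even
  (Fℤ.flow (λ { 0F → + 1 ; 1F → a ; 2F → b ; 3F → c }) (λ { 0F → is1 ; 1F → sa ; 2F → sb ; 3F → sc })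
    λ { 0F → ∂≡0 0F ; 1F → ∂≡0 1F ; 2F → ∂≡0 2F })

-- The vertex off the doubled edge keeps degree 2, so a flow has to be exhibited in each case.
triangle-verdict : ∀ x y x≢y → Verdict (addEdge triangle x y x≢y)
triangle-verdict 0F 0F x≢y = contradiction refl x≢y
triangle-verdict 0F 1F x≢y = doubled-triangle x≢y 2F (- + 2) (- + 1) (+ 1) is-2 is-1 is1 (divides 1 refl)
  λ { 0F → refl ; 1F → refl ; 2F → refl }
triangle-verdict 0F 2F x≢y = doubled-triangle x≢y 1F (+ 1) (+ 1) (- + 2) is1 is1 is-2 (divides 1 refl)
  λ { 0F → refl ; 1F → refl ; 2F → refl }
triangle-verdict 1F 0F x≢y = doubled-triangle x≢y 2F (+ 2) (+ 1) (- + 1) is2 is1 is-1 (divides 1 refl)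
  λ { 0F → refl ; 1F → refl ; 2F → refl }
triangle-verdict 1F 1F x≢y = contradiction refl x≢y
triangle-verdict 1F 2F x≢y = doubled-triangle x≢y 0F (- + 1) (- + 2) (+ 1) is-1 is-2 is1 (divides 1 refl)
  λ { 0F → refl ; 1F → refl ; 2F → refl }
triangle-verdict 2F 0F x≢y = doubled-triangle x≢y 1F (- + 1) (- + 1) (+ 2) is-1 is-1 is2 (divides 1 refl)
  λ { 0F → refl ; 1F → refl ; 2F → refl }
triangle-verdict 2F 1F x≢y = doubled-triangle x≢y 0F (+ 1) (+ 2) (- + 1) is1 is2 is-1 (divides 1 refl)
  λ { 0F → refl ; 1F → refl ; 2F → refl }
triangle-verdict 2F 2F x≢y = contradiction refl x≢y

tree-size : Tree G → 3 ≤ ∣V∣ G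
tree-size base         = s≤s (s≤s (s≤s z≤n))
tree-size (extend t _) = m≤n⇒m≤1+n (tree-size t)

precisely-two-map : G ≅ H → PreciselyTwoLeaves G → PreciselyTwoLeaves H
precisely-two-map {G} {H} i (u , v , u≢v , lu , lv , only) =
  i · u , i · v , u≢v ∘ ·-injective i , trans (degree-map i u) lu , trans (degree-map i v) lv , only′
  where
  only′ : ∀ w → Leaf H w → w ≡ i · u ⊎ w ≡ i · v
  only′ w lw with only (≅-sym i · w) (trans (degree-map (≅-sym i) w) lw)
  ... | inj₁ eq = inj₁ (trans (sym (·-sym-· i w)) (cong (i ·_) eq))
  ... | inj₂ eq = inj₂ (trans (sym (·-sym-· i w)) (cong (i ·_) eq))

∈-pair : ∀ {n} {a b x y u : Fin n} → a ≢ b → x ≢ y → x ∈[ a , b ] → y ∈[ a , b ] → u ∈[ a , b ] → u ∈[ x , y ]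
∈-pair _ x≢y (inj₁ refl) (inj₁ refl) _ = contradiction refl x≢y
∈-pair _ x≢y (inj₁ refl) (inj₂ refl) u∈ = u∈
∈-pair _ x≢y (inj₂ refl) (inj₁ refl) u∈ = swap u∈
∈-pair _ x≢y (inj₂ refl) (inj₂ refl) _ = contradiction refl x≢y

two-leaves : PreciselyTwoLeaves G → ∀ {x y u} → x ≢ y → Leaf G x → Leaf G y → Leaf G u → u ∈[ x , y ]
two-leaves (a , b , a≢b , _ , _ , only) {x} {y} {u} x≢y lx ly lu = ∈-pair a≢b x≢y (only x lx) (only y ly) (only u lu)

path-verdict : ∀ {v r s p q} → Strip H v r s p q → (i : attach H p q ≅ G) → ∀ {x y} (x≢y : x ≢ y) →
               i · zero ∈[ x , y ] → i · suc v ∈[ x , y ] → Verdict (addEdge G x y x≢y)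
path-verdict strip i x≢y (inj₁ refl) (inj₁ eq) with () ← ·-injective i eq
path-verdict strip i x≢y (inj₁ refl) (inj₂ refl) =
  verdict-map (addEdge-cong i (λ ()) x≢y) (state-verdict strip {λ ()} (strip-state strip))
path-verdict strip i x≢y (inj₂ refl) (inj₁ refl) =
  verdict-map (≅-trans (addEdge-cong i (λ ()) (x≢y ∘ sym)) (addEdge-swap (x≢y ∘ sym) x≢y))
    (state-verdict strip {λ ()} (strip-state strip))
path-verdict strip i x≢y (inj₂ refl) (inj₂ eq) with () ← ·-injective i eq

tree-verdict : Tree G → ∣V∣ G ≡ 3 ⊎ (4 ≤ ∣V∣ G × PreciselyTwoLeaves G) →
               ∀ {x y} (x≢y : x ≢ y) → Leaf G x → Leaf G y → Verdict (addEdge G x y x≢y)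
tree-verdict base         (inj₁ _)    x≢y _ _ = triangle-verdict _ _ x≢y
tree-verdict (extend t _) (inj₁ size) x≢y _ _ =
  contradiction (subst (4 ≤_) size (s≤s (tree-size t))) (n≮n 3)
tree-verdict {G} t (inj₂ (size , two)) x≢y lx ly with tree-shape t
... | triangular i = contradiction (subst (4 ≤_) (sym (Perm.↔⇒≡ (_≅_.vertices i))) size) (n≮n 3)
-- The two ends of the strip are leaves, hence they are x and y in some order.
... | path {v = v} strip i = path-verdict strip i x≢y
  (two-leaves {G} two x≢y lx ly (trans (degree-map i zero) (FarLeaves.leaf₁ ends)))
  (two-leaves {G} two x≢y lx ly (trans (degree-map i (suc v)) (FarLeaves.leaf₂ ends)))
  where ends = tip-far strip
... | branched (farLeaves la lb a≢b _) (farLeaves _ lc a≢c _) bc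
  with two-leaves {G} two a≢b la lb lc
...   | inj₁ c≡a = contradiction (sym c≡a) a≢c
...   | inj₂ c≡b = contradiction (sym c≡b) (FarLeaves.distinct bc)

crystal-tree : Crystal G → Σ[ T ∈ Graph ] Σ[ x ∈ Vertex T ] Σ[ y ∈ Vertex T ] Σ[ x≢y ∈ x ≢ y ]
               Tree T × (∣V∣ T ≡ 3 ⊎ (4 ≤ ∣V∣ T × PreciselyTwoLeaves T)) ×
               Leaf T x × Leaf T y × addEdge T x y x≢y ≅ G
crystal-tree (P , x , y , x≢y , (t , size) , lx , ly , c) with T , t′ , i ← normalise t =
  let j = ≅-sym i in
  T , j · x , j · y , x≢y ∘ ·-injective j , t′ , map-size size ,
  trans (degree-map j x) lx , trans (degree-map j y) ly ,
  ≅-trans (≅-sym (addEdge-cong j x≢y (x≢y ∘ ·-injective j))) c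
  where
  map-size : ∣V∣ P ≡ 3 ⊎ (4 ≤ ∣V∣ P × PreciselyTwoLeaves P) → ∣V∣ T ≡ 3 ⊎ (4 ≤ ∣V∣ T × PreciselyTwoLeaves T)
  map-size (inj₁ size)         = inj₁ (trans (Perm.↔⇒≡ (_≅_.vertices i)) size)
  map-size (inj₂ (size , two)) = inj₂
    (subst (4 ≤_) (sym (Perm.↔⇒≡ (_≅_.vertices i))) size , precisely-two-map (≅-sym i) two)

corollary1p10 : (∀ G → Crystal G → (¬ HasNowhereZero3Flow G) ⇔ (∀ v → Odd (Graph.degree G v))) ×
    (∀ G → Crystal G → ℤ₃-Connected G ⇔ Vertex-3-Colorable G)
corollary1p10 =
  (λ G crystal → let T , x , y , x≢y , t , size , lx , ly , i = crystal-tree crystal in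
    verdict⇒⇔ (verdict-map i (tree-verdict t size x≢y lx ly))) ,
  (λ G crystal → let T , x , y , x≢y , t , _ , _ , _ , i = crystal-tree crystal in
    mk⇔ (colorable-map i ∘ Mod3-Connected⇒colorable t x≢y ∘ Mod3-Connected-map (≅-sym i) ∘ ℤ₃-Connected⇒Mod3)
        (Mod3⇒ℤ₃-Connected ∘ Mod3-Connected-map i ∘ colorable⇒Mod3-Connected t x≢y ∘ colorable-map (≅-sym i)))
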